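{- Let $n\geq 1$ and suppose that $\Pi\subseteq\mathfrak{S}_{n}$ is invariant under the modified Foata--Strehl action. Then $$A(\Pi;t)=\left(\frac{1+yt}{1+y}\right)^{n+1}P^{(\mathrm{pk},\mathrm{des})}\left(\Pi;\frac{(1+y)^{2}t}{(y+t)(1+yt)},\frac{y+t}{1+yt}\right).$$ Equivalently, $$P^{(\mathrm{pk},\mathrm{des})}(\Pi;y,t)=\left(\frac{1+u}{1+uv}\right)^{n+1}A(\Pi;v),$$ where $$u=\frac{1+t^{2}-2yt-(1-t)\sqrt{(1+t)^{2}-4yt}}{2(1-y)t},\qquad v=\frac{(1+t)^{2}-2yt-(1+t)\sqrt{(1+t)^{2}-4yt}}{2yt}.$$
   Context: $\mathfrak{S}_n$ is the set of permutations $\pi=\pi_1\cdots\pi_n$ of $[n]=\{1,\dots,n\}$. For $\pi\in\mathfrak{S}_n$, $\mathrm{des}(\pi)$ is the number of $i\in[n-1]$ with $\pi_i>\pi_{i+1}$, and $\mathrm{pk}(\pi)$ is the number of $i$ with $2\le i\le n-1$ and $\pi_{i-1}<\pi_i>\pi_{i+1}$. For $\Pi\subseteq\mathfrak{S}_n$, $A(\Pi;t)=\sum_{\pi\in\Pi}t^{\mathrm{des}(\pi)+1}$ and $P^{(\mathrm{pk},\mathrm{des})}(\Pi;y,t)=\sum_{\pi\in\Pi}y^{\mathrm{pk}(\pi)+1}t^{\mathrm{des}(\pi)+1}$. Modified Foata--Strehl action. For $\pi\in\mathfrak{S}_n$ and $x\in[n]$, the $x$-factorization of $\pi$ is $\pi=w_1w_2xw_4w_5$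 (concatenation of words), where $w_2$ is the maximal consecutive subword immediately to the left of $x$ all of whose letters are smaller than $x$, and $w_4$ is the maximal consecutive subword immediately to the right of $x$ all of whose letters are smaller than $x$ (any of these words may be empty). Set $\varphi_x(\pi)=w_1w_4xw_2w_5$. Define $\varphi'_x(\pi)=\varphi_x(\pi)$ if exactly one of $w_2,w_4$ is nonempty (equivalently, if the letter $x$ is a double ascent or double descent of $\infty\pi\infty$, i.e. with $\pi_0=\pi_{n+1}=\infty$ and $x=\pi_i$ one has $\pi_{i-1}<\pi_i<\pi_{i+1}$ or $\pi_{i-1}>\pi_i>\pi_{i+1}$), and $\varphi'_x(\pi)=\pi$ otherwise. The maps $\varphi'_x$ are commuting involutions of $\mathfrak{S}_n$; for $S\subseteq[n]$ put $\varphi'_S=\prod_{x\in S}\varphi'_x$. The group $\mathbb{Z}_2^n$ acts on $\mathfrak{S}_n$ via the $\varphi'_S$, $S\subseteq[n]$; this is the modified Foata--Strehl action, and $\Pi$ is invariant if $\varphi'_S(\pi)\in\Pi$ for all $\pi\in\Pi$ and $S\subseteq[n]$. Here $y,t$ are indeterminates; the first identity is an identity of rational functions in $y,t$. In the second identity, $\sqrt{(1+t)^2-4yt}$ is the formal power series in $t$ over $\mathbb{Q}[y]$ with constant term $1$, so that $u$ and $v$ are formal power series in $t$ with coefficients in $\mathbb{Q}[y]$. -}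

module Defs where

open import Algebra.Bundles using (CommutativeRing)
import Algebra.Construct.Pointwise as Pointwise
import Algebra.Properties.CommutativeSemigroup as CommutativeSemigroupProperties
import Algebra.Properties.Monoid.Sum as MonoidSum
import Algebra.Properties.Ring as RingProperties
import Algebra.Properties.Semiring.Exp as SemiringExp
import Algebra.Solver.Ring.NaturalCoefficients.Default as SemiringSolver
open import Data.Bool.Base using (Bool; _∧_; _xor_; if_then_else_)
open import Data.Fin.Base using (toℕ)
open import Data.Fin.Subset using (Subset)
open import Data.List.Base
  using (List; []; _∷_; _++_; map; foldr; reverse; takeWhile; dropWhile; drop;
         null; upTo; allFin)
open import Data.List.Membership.Propositional using (_∈_)
open import Data.List.Relation.Binary.Permutation.Propositional using (_↭_)
open import Data.List.Relation.Unary.All using (All)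
open import Data.List.Relation.Unary.Unique.Propositional using (Unique)
open import Data.Nat.Base as ℕ using (ℕ; zero; suc; _∸_; _≤_; _<ᵇ_; z≤n; s≤s)
import Data.Nat.Properties as ℕ
open import Data.Product.Base using (Σ; ∃; _×_; _,_; proj₁; proj₂)
open import Data.Rational.Properties using (+-*-commutativeRing)
open import Data.Sum.Base using (inj₁; inj₂)
import Data.Vec.Base as Vec
open import Function.Base using (_∘_; id)
open import Level using (Level; _⊔_; 0ℓ)
import Relation.Binary.Reasoning.Setoid as SetoidReasoning
open import Relation.Nullary.Decidable.Core using (¬?)

private
  variable
    c ℓ : Level

-- Permutations of [n] are words π₁ ⋯ πₙ in the letters 1, …, n.

[1⋯_] : ℕ → List ℕ
[1⋯ n ] = map suc (upTo n)

IsPermutation : ℕ → List ℕ → Set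
IsPermutation n w = w ↭ [1⋯ n ]

count : Bool → ℕ
count b = if b then 1 else 0

des : List ℕ → ℕ
des (a ∷ b ∷ w) = count (b <ᵇ a) ℕ.+ des (b ∷ w)
des _           = 0

pk : List ℕ → ℕ
pk (a ∷ b ∷ d ∷ w) = count ((a <ᵇ b) ∧ (d <ᵇ b)) ℕ.+ pk (b ∷ d ∷ w)
pk _               = 0

-- A subset of 𝔖ₙ, given by listing its elements without repetition.

record PermutationSet (n : ℕ) : Set where
  field
    words        : List (List ℕ)
    unique       : Unique words
    permutations : All (IsPermutation n) words

open PermutationSet public

record Factorization : Set where
  constructor factors
  field
    w₁ w₂ w₄ w₅ : List ℕ

-- The factorization w₁ w₂ x w₄ w₅ of a word, meaningful only when x
-- occurs in it.

factorization : ℕ → List ℕ → Factorization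
factorization x w = factors
  (reverse (dropWhile (ℕ._<? x) (reverse left)))
  (reverse (takeWhile (ℕ._<? x) (reverse left)))
  (takeWhile (ℕ._<? x) right)
  (dropWhile (ℕ._<? x) right)
  where
  left right : List ℕ
  left  = takeWhile (¬? ∘ (ℕ._≟ x)) w
  right = drop 1 (dropWhile (¬? ∘ (ℕ._≟ x)) w)

φ : ℕ → List ℕ → List ℕ
φ x w = w₁ ++ w₄ ++ x ∷ w₂ ++ w₅
  where open Factorization (factorization x w)

φ′ : ℕ → List ℕ → List ℕ
φ′ x w = if null w₂ xor null w₄ then φ x w else w
  where open Factorization (factorization x w)

-- The element i of Fin n stands for the letter i + 1 of [n].  The maps
-- φ′ x commute on permutations, so the order of composition is immaterial.

φ′[_] : ∀ {n} → Subset n → List ℕ → List ℕ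
φ′[_] {n} S w =
  foldr (λ i → if Vec.lookup S i then φ′ (suc (toℕ i)) else id) w (allFin n)

Invariant : ∀ {n} → PermutationSet n → Set
Invariant {n} Π =
  ∀ (w : List ℕ) → w ∈ words Π → ∀ (S : Subset n) → φ′[ S ] w ∈ words Π

module Over (R : CommutativeRing c ℓ) where

  open CommutativeRing R public
  open SemiringExp semiring public using (_^_)

  2# : Carrier
  2# = 1# + 1#

  -- A and P have coefficients in ℕ, so substituting for t, respectively
  -- for y and t, makes sense in any commutative ring.

  A : ∀ {n} → PermutationSet n → Carrier → Carrier
  A Π t = foldr (λ w s → t ^ suc (des w) + s) 0# (words Π)

  P : ∀ {n} → PermutationSet n → Carrier → Carrier → Carrier
  P Π y t = foldr (λ w s → y ^ suc (pk w) * t ^ suc (des w) + s) 0# (words Π)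

  record Regular (q : Carrier) : Set (c ⊔ ℓ) where
    constructor mkRegular
    field
      annihilates : ∀ p → q * p ≈ 0# → p ≈ 0#

  open Regular public

  -- x is the quotient p / q; regularity of q makes it unique.

  infix 4 _≈_÷_

  _≈_÷_ : Carrier → Carrier → Carrier → Set (c ⊔ ℓ)
  x ≈ p ÷ q = Regular q × q * x ≈ p

  Regular-cong : ∀ {q r} → q ≈ r → Regular q → Regular r
  Regular-cong q≈r q-reg = mkRegular λ p rp≈0 →
    annihilates q-reg p (trans (*-congʳ q≈r) rp≈0)

  Regular-1# : Regular 1#
  Regular-1# = mkRegular λ p eq → trans (sym (*-identityˡ p)) eq

  Regular-* : ∀ {q r} → Regular q → Regular r → Regular (q * r)
  Regular-* {q} {r} q-reg r-reg = mkRegular λ p eq →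
    annihilates r-reg p (annihilates q-reg (r * p) (trans (sym (*-assoc q r p)) eq))

-- The total ring of fractions, with regular denominators.  When R is an
-- integral domain, the regular elements are the nonzero ones and this is
-- the field of fractions.

module Fractions (R : CommutativeRing c ℓ) where

  open Over R
  open SetoidReasoning setoid

  infix 5 _/_∵_

  record Fraction : Set (c ⊔ ℓ) where
    constructor _/_∵_
    field
      num     : Carrier
      den     : Carrier
      regular : Regular den

  open Fraction

  private
    module Solver = SemiringSolver commutativeSemiring
    open Solver using (solve; _:=_; _:*_; _:+_; con)
    open RingProperties ring using (-‿distribˡ-*; x∙y⁻¹≈ε⇒x≈y)

    infix 4 _≃_

    _≃_ : Fraction → Fraction → Set ℓ
    p ≃ q = num p * den q ≈ num q * den p

    cancel : ∀ {d x y} → Regular d → d * x ≈ d * y → x ≈ y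
    cancel {d} {x} {y} d-reg eq = x∙y⁻¹≈ε⇒x≈y x y (annihilates d-reg (x - y) (begin
      d * (x - y)        ≈⟨ distribˡ d x (- y) ⟩
      d * x + d * - y    ≈⟨ +-cong eq (*-comm d (- y)) ⟩
      d * y + - y * d    ≈⟨ +-congˡ (-‿distribˡ-* y d) ⟨
      d * y + - (y * d)  ≈⟨ +-congˡ (-‿cong (*-comm y d)) ⟩
      d * y + - (d * y)  ≈⟨ -‿inverseʳ (d * y) ⟩
      0#                 ∎))

    ≃-trans : ∀ {p q r} → p ≃ q → q ≃ r → p ≃ r
    ≃-trans {a / b ∵ _} {d / e ∵ e-reg} {f / g ∵ _} p≃q q≃r = cancel e-reg (begin
      e * (a * g)  ≈⟨ solve 3 (λ e a g → e :* (a :* g) := (a :* e) :* g) refl e a g ⟩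
      a * e * g    ≈⟨ *-congʳ p≃q ⟩
      d * b * g    ≈⟨ solve 3 (λ d b g → (d :* b) :* g := (d :* g) :* b) refl d b g ⟩
      d * g * b    ≈⟨ *-congʳ q≃r ⟩
      f * e * b    ≈⟨ solve 3 (λ f e b → (f :* e) :* b := e :* (f :* b)) refl f e b ⟩
      e * (f * b)  ∎)

    infix  8 ⊖_
    infixl 7 _⊗_
    infixl 6 _⊕_

    _⊕_ _⊗_ : Fraction → Fraction → Fraction
    p ⊕ q = num p * den q + num q * den p / den p * den q ∵ Regular-* (regular p) (regular q)
    p ⊗ q = num p * num q / den p * den q ∵ Regular-* (regular p) (regular q)

    ⊖_ : Fraction → Fraction
    ⊖ p = - num p / den p ∵ regular p

    ⊕-cong : ∀ {p q r s} → p ≃ q → r ≃ s → p ⊕ r ≃ q ⊕ s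
    ⊕-cong {a / b ∵ _} {a′ / b′ ∵ _} {d / e ∵ _} {d′ / e′ ∵ _} p≃q r≃s = begin
      (a * e + d * b) * (b′ * e′)
        ≈⟨ solve 6 (λ a b d e b′ e′ → (a :* e :+ d :* b) :* (b′ :* e′)
             := (a :* b′) :* (e :* e′) :+ (d :* e′) :* (b :* b′)) refl a b d e b′ e′ ⟩
      a * b′ * (e * e′) + d * e′ * (b * b′)
        ≈⟨ +-cong (*-congʳ p≃q) (*-congʳ r≃s) ⟩
      a′ * b * (e * e′) + d′ * e * (b * b′)
        ≈⟨ solve 6 (λ a′ b′ d′ e′ b e → (a′ :* b) :* (e :* e′) :+ (d′ :* e) :* (b :* b′)
             := (a′ :* e′ :+ d′ :* b′) :* (b :* e)) refl a′ b′ d′ e′ b e ⟩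
      (a′ * e′ + d′ * b′) * (b * e)  ∎

    ⊗-cong : ∀ {p q r s} → p ≃ q → r ≃ s → p ⊗ r ≃ q ⊗ s
    ⊗-cong {a / b ∵ _} {a′ / b′ ∵ _} {d / e ∵ _} {d′ / e′ ∵ _} p≃q r≃s = begin
      a * d * (b′ * e′)    ≈⟨ solve 4 (λ a d b′ e′ → (a :* d) :* (b′ :* e′)
                                := (a :* b′) :* (d :* e′)) refl a d b′ e′ ⟩
      a * b′ * (d * e′)    ≈⟨ *-cong p≃q r≃s ⟩
      a′ * b * (d′ * e)    ≈⟨ solve 4 (λ a′ b d′ e → (a′ :* b) :* (d′ :* e)
                                := (a′ :* d′) :* (b :* e)) refl a′ b d′ e ⟩
      a′ * d′ * (b * e)    ∎

    ⊖-cong : ∀ {p q} → p ≃ q → ⊖ p ≃ ⊖ q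
    ⊖-cong {a / b ∵ _} {a′ / b′ ∵ _} p≃q = begin
      - a * b′      ≈⟨ -‿distribˡ-* a b′ ⟨
      - (a * b′)    ≈⟨ -‿cong p≃q ⟩
      - (a′ * b)    ≈⟨ -‿distribˡ-* a′ b ⟩
      - a′ * b      ∎

    ⊖-inverseˡ : ∀ p → num (⊖ p ⊕ p) * 1# ≈ 0# * den (⊖ p ⊕ p)
    ⊖-inverseˡ (a / b ∵ _) = begin
      (- a * b + a * b) * 1#  ≈⟨ *-identityʳ _ ⟩
      - a * b + a * b         ≈⟨ distribʳ b (- a) a ⟨
      (- a + a) * b           ≈⟨ *-congʳ (-‿inverseˡ a) ⟩
      0# * b                  ≈⟨ zeroˡ b ⟩
      0#                      ≈⟨ zeroˡ (b * b) ⟨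
      0# * (b * b)            ∎

    ⊖-inverseʳ : ∀ p → num (p ⊕ ⊖ p) * 1# ≈ 0# * den (p ⊕ ⊖ p)
    ⊖-inverseʳ (a / b ∵ r) = trans (*-congʳ (+-comm (a * b) (- a * b))) (⊖-inverseˡ (a / b ∵ r))

  commutativeRing : CommutativeRing (c ⊔ ℓ) ℓ
  commutativeRing = record
    { Carrier = Fraction
    ; _≈_ = _≃_
    ; _+_ = _⊕_
    ; _*_ = _⊗_
    ; -_  = ⊖_
    ; 0#  = 0# / 1# ∵ Regular-1#
    ; 1#  = 1# / 1# ∵ Regular-1#
    ; isCommutativeRing = record
      { isRing = record
        { +-isAbelianGroup = record
          { isGroup = record
            { isMonoid = record
              { isSemigroup = record
                { isMagma = record
                  { isEquivalence = record
                    { refl  = refl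
                    ; sym   = sym
                    ; trans = λ {p} {q} {r} → ≃-trans {p} {q} {r}
                    }
                  ; ∙-cong = λ {p} {q} {r} {s} → ⊕-cong {p} {q} {r} {s}
                  }
                ; assoc = λ p q r →
                    solve 6 (λ a b d e f g →
                      ((a :* e :+ d :* b) :* g :+ f :* (b :* e)) :* (b :* (e :* g)) :=
                      (a :* (e :* g) :+ (d :* g :+ f :* e) :* b) :* ((b :* e) :* g))
                    refl (num p) (den p) (num q) (den q) (num r) (den r)
                }
              ; identity =
                  (λ p → solve 2 (λ a b → (con 0 :* b :+ a :* con 1) :* b :=
                                          a :* (con 1 :* b)) refl (num p) (den p))
                , (λ p → solve 2 (λ a b → (a :* con 1 :+ con 0 :* b) :* b :=
                                          a :* (b :* con 1)) refl (num p) (den p))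
              }
            ; inverse = ⊖-inverseˡ , ⊖-inverseʳ
            ; ⁻¹-cong = λ {p} {q} → ⊖-cong {p} {q}
            }
          ; comm = λ p q →
              solve 4 (λ a b d e → (a :* e :+ d :* b) :* (e :* b) :=
                                   (d :* b :+ a :* e) :* (b :* e))
              refl (num p) (den p) (num q) (den q)
          }
        ; *-cong  = λ {p} {q} {r} {s} → ⊗-cong {p} {q} {r} {s}
        ; *-assoc = λ p q r →
            solve 6 (λ a b d e f g → ((a :* d) :* f) :* (b :* (e :* g)) :=
                                     (a :* (d :* f)) :* ((b :* e) :* g))
            refl (num p) (den p) (num q) (den q) (num r) (den r)
        ; *-identity =
            (λ p → solve 2 (λ a b → (con 1 :* a) :* b := a :* (con 1 :* b))
                   refl (num p) (den p))
          , (λ p → solve 2 (λ a b → (a :* con 1) :* b := a :* (b :* con 1))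
                   refl (num p) (den p))
        ; distrib =
            (λ p q r → solve 6 (λ a b d e f g →
               (a :* (d :* g :+ f :* e)) :* ((b :* e) :* (b :* g)) :=
               ((a :* d) :* (b :* g) :+ (a :* f) :* (b :* e)) :* (b :* (e :* g)))
               refl (num p) (den p) (num q) (den q) (num r) (den r))
          , (λ p q r → solve 6 (λ a b d e f g →
               ((d :* g :+ f :* e) :* a) :* ((e :* b) :* (g :* b)) :=
               ((d :* a) :* (g :* b) :+ (f :* a) :* (e :* b)) :* ((e :* g) :* b))
               refl (num p) (den p) (num q) (den q) (num r) (den r))
        }
      ; *-comm = λ p q →
          solve 4 (λ a b d e → (a :* d) :* (e :* b) := (d :* a) :* (b :* e))
          refl (num p) (den p) (num q) (den q)
      }
    }

module PowerSeries (R : CommutativeRing c ℓ) where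

  open Over R
  open MonoidSum +-monoid using (sum-syntax; sum⁺-syntax; sum-cong-≋; sum-replicate-zero)
  open CommutativeSemigroupProperties +-commutativeSemigroup using (interchange; x∙yz≈y∙xz)
  open SetoidReasoning setoid

  Series : Set c
  Series = ℕ → Carrier

  constant : Carrier → Series
  constant a zero    = a
  constant a (suc _) = 0#

  indeterminate : Series
  indeterminate 1 = 1#
  indeterminate _ = 0#

  infixl 7 _⊛_

  _⊛_ : Series → Series → Series
  (f ⊛ g) n = ∑[ i ≤ n ] (f (toℕ i) * g (n ∸ toℕ i))

  private
    tail : Series → Series
    tail f = f ∘ suc

    ⊛-cong : ∀ {f f′ g g′} → (∀ n → f n ≈ f′ n) → (∀ n → g n ≈ g′ n) →
             ∀ n → (f ⊛ g) n ≈ (f′ ⊛ g′) n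
    ⊛-cong f≈ g≈ n = sum-cong-≋ {suc n} (λ i → *-cong (f≈ (toℕ i)) (g≈ (n ∸ toℕ i)))

    ⊛-distribʳ : ∀ h f g n → ((λ k → f k + g k) ⊛ h) n ≈ (f ⊛ h) n + (g ⊛ h) n
    ⊛-distribʳ h f g zero = begin
      (f 0 + g 0) * h 0 + 0#                 ≈⟨ +-identityʳ _ ⟩
      (f 0 + g 0) * h 0                      ≈⟨ distribʳ (h 0) (f 0) (g 0) ⟩
      f 0 * h 0 + g 0 * h 0                  ≈⟨ +-cong (+-identityʳ _) (+-identityʳ _) ⟨
      (f 0 * h 0 + 0#) + (g 0 * h 0 + 0#)    ∎
    ⊛-distribʳ h f g (suc n) = begin
      (f 0 + g 0) * h (suc n) + ((λ k → f (suc k) + g (suc k)) ⊛ h) n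
        ≈⟨ +-cong (distribʳ (h (suc n)) (f 0) (g 0)) (⊛-distribʳ h (tail f) (tail g) n) ⟩
      (f 0 * h (suc n) + g 0 * h (suc n)) + ((tail f ⊛ h) n + (tail g ⊛ h) n)
        ≈⟨ interchange _ _ _ _ ⟩
      (f ⊛ h) (suc n) + (g ⊛ h) (suc n)  ∎

    scale-⊛ : ∀ a f g n → ((λ k → a * f k) ⊛ g) n ≈ a * (f ⊛ g) n
    scale-⊛ a f g zero = begin
      a * f 0 * g 0 + 0#      ≈⟨ +-identityʳ _ ⟩
      a * f 0 * g 0           ≈⟨ *-assoc a (f 0) (g 0) ⟩
      a * (f 0 * g 0)         ≈⟨ *-congˡ (+-identityʳ _) ⟨
      a * (f 0 * g 0 + 0#)    ∎
    scale-⊛ a f g (suc n) = begin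
      a * f 0 * g (suc n) + ((λ k → a * f (suc k)) ⊛ g) n
        ≈⟨ +-cong (*-assoc a (f 0) (g (suc n))) (scale-⊛ a (tail f) g n) ⟩
      a * (f 0 * g (suc n)) + a * (tail f ⊛ g) n
        ≈⟨ distribˡ a _ _ ⟨
      a * (f ⊛ g) (suc n)  ∎

    ⊛-suc : ∀ f g n → (f ⊛ g) (suc n) ≈ f (suc n) * g 0 + (f ⊛ tail g) n
    ⊛-suc f g zero = begin
      f 0 * g 1 + (f 1 * g 0 + 0#)  ≈⟨ x∙yz≈y∙xz _ _ _ ⟩
      f 1 * g 0 + (f 0 * g 1 + 0#)  ∎
    ⊛-suc f g (suc n) = begin
      f 0 * g (suc (suc n)) + (tail f ⊛ g) (suc n)
        ≈⟨ +-congˡ (⊛-suc (tail f) g n) ⟩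
      f 0 * g (suc (suc n)) + (f (suc (suc n)) * g 0 + (tail f ⊛ tail g) n)
        ≈⟨ x∙yz≈y∙xz _ _ _ ⟩
      f (suc (suc n)) * g 0 + (f ⊛ tail g) (suc n)  ∎

    ⊛-comm : ∀ f g n → (f ⊛ g) n ≈ (g ⊛ f) n
    ⊛-comm f g zero    = +-congʳ (*-comm (f 0) (g 0))
    ⊛-comm f g (suc n) = begin
      f 0 * g (suc n) + (tail f ⊛ g) n
        ≈⟨ +-cong (*-comm (f 0) (g (suc n))) (⊛-comm (tail f) g n) ⟩
      g (suc n) * f 0 + (g ⊛ tail f) n
        ≈⟨ ⊛-suc g f n ⟨
      (g ⊛ f) (suc n)  ∎

    ⊛-assoc : ∀ f g h n → ((f ⊛ g) ⊛ h) n ≈ (f ⊛ (g ⊛ h)) n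
    ⊛-assoc f g h zero = +-congʳ (begin
      (f 0 * g 0 + 0#) * h 0    ≈⟨ *-congʳ (+-identityʳ _) ⟩
      f 0 * g 0 * h 0           ≈⟨ *-assoc (f 0) (g 0) (h 0) ⟩
      f 0 * (g 0 * h 0)         ≈⟨ *-congˡ (+-identityʳ _) ⟨
      f 0 * (g 0 * h 0 + 0#)    ∎)
    ⊛-assoc f g h (suc n) = begin
      (f 0 * g 0 + 0#) * h (suc n) + ((λ k → f 0 * g (suc k) + (tail f ⊛ g) k) ⊛ h) n
        ≈⟨ +-cong (*-congʳ (+-identityʳ _))
             (⊛-distribʳ h (λ k → f 0 * g (suc k)) (tail f ⊛ g) n) ⟩
      f 0 * g 0 * h (suc n) + (((λ k → f 0 * g (suc k)) ⊛ h) n + ((tail f ⊛ g) ⊛ h) n)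
        ≈⟨ +-cong (*-assoc _ _ _) (+-cong (scale-⊛ (f 0) (tail g) h n) (⊛-assoc (tail f) g h n)) ⟩
      f 0 * (g 0 * h (suc n)) + (f 0 * (tail g ⊛ h) n + (tail f ⊛ (g ⊛ h)) n)
        ≈⟨ +-assoc _ _ _ ⟨
      (f 0 * (g 0 * h (suc n)) + f 0 * (tail g ⊛ h) n) + (tail f ⊛ (g ⊛ h)) n
        ≈⟨ +-congʳ (distribˡ (f 0) _ _) ⟨
      (f ⊛ (g ⊛ h)) (suc n)  ∎

    0⊛ : ∀ f n → ((λ _ → 0#) ⊛ f) n ≈ 0#
    0⊛ f n = trans (sum-cong-≋ {suc n} (λ i → zeroˡ (f (n ∸ toℕ i)))) (sum-replicate-zero (suc n))

    constant⊛ : ∀ a f n → (constant a ⊛ f) n ≈ a * f n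
    constant⊛ a f zero    = +-identityʳ _
    constant⊛ a f (suc n) = trans (+-congˡ (0⊛ f n)) (+-identityʳ _)

    1⊛ : ∀ f n → (constant 1# ⊛ f) n ≈ f n
    1⊛ f n = trans (constant⊛ 1# f n) (*-identityˡ (f n))

  regular-series : ∀ f → Regular (f 0) → ∀ g → (∀ n → (f ⊛ g) n ≈ 0#) → ∀ n → g n ≈ 0#
  regular-series f f₀-reg g fg≈0 zero =
    annihilates f₀-reg (g 0) (trans (sym (+-identityʳ _)) (fg≈0 0))
  regular-series f f₀-reg g fg≈0 (suc n) = regular-series f f₀-reg (tail g) f⊛tail-g≈0 n
    where
    g₀≈0 : g 0 ≈ 0#
    g₀≈0 = annihilates f₀-reg (g 0) (trans (sym (+-identityʳ _)) (fg≈0 0))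

    f⊛tail-g≈0 : ∀ n → (f ⊛ tail g) n ≈ 0#
    f⊛tail-g≈0 n = begin
      (f ⊛ tail g) n                      ≈⟨ +-identityˡ _ ⟨
      0# + (f ⊛ tail g) n                 ≈⟨ +-congʳ (trans (*-congˡ g₀≈0) (zeroʳ _)) ⟨
      f (suc n) * g 0 + (f ⊛ tail g) n    ≈⟨ ⊛-suc f g n ⟨
      (f ⊛ g) (suc n)                     ≈⟨ fg≈0 (suc n) ⟩
      0#                                  ∎

  regular-indeterminate : ∀ g → (∀ n → (indeterminate ⊛ g) n ≈ 0#) → ∀ n → g n ≈ 0#
  regular-indeterminate g Xg≈0 n = begin
    g n                                     ≈⟨ 1⊛ g n ⟨
    (constant 1# ⊛ g) n                     ≈⟨ ⊛-cong tail-indeterminate (λ k → refl {g k}) n ⟨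
    (tail indeterminate ⊛ g) n              ≈⟨ +-identityˡ _ ⟨
    0# + (tail indeterminate ⊛ g) n         ≈⟨ +-congʳ (zeroˡ (g (suc n))) ⟨
    (indeterminate ⊛ g) (suc n)             ≈⟨ Xg≈0 (suc n) ⟩
    0#                                      ∎
    where
    tail-indeterminate : ∀ n → indeterminate (suc n) ≈ constant 1# n
    tail-indeterminate zero    = refl
    tail-indeterminate (suc n) = refl

  -- The ring is opaque so that comparing two of its elements for
  -- definitional equality never expands the sums above.

  opaque

    commutativeRing : CommutativeRing c ℓ
    commutativeRing = record
      { Carrier = Series
      ; _≈_ = λ f g → ∀ n → f n ≈ g n
      ; _+_ = λ f g n → f n + g n
      ; _*_ = _⊛_
      ; -_  = λ f n → - f n
      ; 0#  = λ _ → 0#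
      ; 1#  = constant 1#
      ; isCommutativeRing = record
        { isRing = record
          { +-isAbelianGroup = Pointwise.isAbelianGroup ℕ +-isAbelianGroup
          ; *-cong     = ⊛-cong
          ; *-assoc    = ⊛-assoc
          ; *-identity = 1⊛ , λ f n → trans (⊛-comm f (constant 1#) n) (1⊛ f n)
          ; distrib    =
              (λ f g h n → begin
                (f ⊛ (λ k → g k + h k)) n    ≈⟨ ⊛-comm f (λ k → g k + h k) n ⟩
                ((λ k → g k + h k) ⊛ f) n    ≈⟨ ⊛-distribʳ f g h n ⟩
                (g ⊛ f) n + (h ⊛ f) n        ≈⟨ +-cong (⊛-comm g f n) (⊛-comm h f n) ⟩
                (f ⊛ g) n + (f ⊛ h) n        ∎)
            , ⊛-distribʳ
          }
        ; *-comm = ⊛-comm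
        }
      }

    X : CommutativeRing.Carrier commutativeRing
    X = indeterminate

    scalar : Carrier → CommutativeRing.Carrier commutativeRing
    scalar = constant

    coefficient : CommutativeRing.Carrier commutativeRing → ℕ → Carrier
    coefficient f = f

  private
    module R⟦X⟧ = Over commutativeRing

  IsSqrt : R⟦X⟧.Carrier → R⟦X⟧.Carrier → Set ℓ
  IsSqrt s f = (s R⟦X⟧.* s R⟦X⟧.≈ f) × (coefficient s 0 ≈ 1#)

-- The polynomial ring R[X], as the power series with finitely many
-- nonzero coefficients

module Polynomials (R : CommutativeRing c ℓ) where

  open Over R
  open PowerSeries R using (Series; _⊛_; constant; indeterminate; regular-series; regular-indeterminate)
  open MonoidSum +-monoid using (sum-cong-≋; sum-replicate-zero)
  open RingProperties ring using (-0#≈0#)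
  private
    module R⟦X⟧ = CommutativeRing (PowerSeries.commutativeRing R)

  FiniteSupport : Series → Set ℓ
  FiniteSupport f = ∃ λ N → ∀ n → N ≤ n → f n ≈ 0#

  Polynomial : Set (c ⊔ ℓ)
  Polynomial = Σ Series FiniteSupport

  private
    constant-finite : ∀ a → FiniteSupport (constant a)
    constant-finite a = 1 , λ { (suc n) _ → refl }

    +-finite : ∀ {f g} → FiniteSupport f → FiniteSupport g → FiniteSupport (λ n → f n + g n)
    +-finite (M , f≈0) (N , g≈0) = M ℕ.+ N , λ n M+N≤n →
      trans (+-cong (f≈0 n (ℕ.≤-trans (ℕ.m≤m+n M N) M+N≤n))
                    (g≈0 n (ℕ.≤-trans (ℕ.m≤n+m N M) M+N≤n)))
            (+-identityʳ 0#)

    *-finite : ∀ {f g} → FiniteSupport f → FiniteSupport g → FiniteSupport (f ⊛ g)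
    *-finite {f} {g} (M , f≈0) (N , g≈0) = M ℕ.+ N , λ n M+N≤n →
      trans (sum-cong-≋ {suc n} (λ i → term n M+N≤n (toℕ i))) (sum-replicate-zero (suc n))
      where
      term : ∀ n → M ℕ.+ N ≤ n → ∀ i → f i * g (n ∸ i) ≈ 0#
      term n M+N≤n i with ℕ.≤-total M i
      ... | inj₁ M≤i = trans (*-congʳ (f≈0 i M≤i)) (zeroˡ _)
      ... | inj₂ i≤M = trans (*-congˡ (g≈0 (n ∸ i) N≤n∸i)) (zeroʳ _)
        where
        N≤n∸i : N ≤ n ∸ i
        N≤n∸i = ℕ.m+n≤o⇒m≤o∸n N
          (ℕ.≤-trans (ℕ.+-monoʳ-≤ N i≤M) (ℕ.≤-trans (ℕ.≤-reflexive (ℕ.+-comm N M)) M+N≤n))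

  opaque
    unfolding PowerSeries.commutativeRing

    commutativeRing : CommutativeRing (c ⊔ ℓ) ℓ
    commutativeRing = record
      { Carrier = Polynomial
      ; _≈_ = λ p q → proj₁ p R⟦X⟧.≈ proj₁ q
      ; _+_ = λ (f , f-fin) (g , g-fin) → f R⟦X⟧.+ g , +-finite f-fin g-fin
      ; _*_ = λ (f , f-fin) (g , g-fin) → f R⟦X⟧.* g , *-finite f-fin g-fin
      ; -_  = λ (f , N , f≈0) → R⟦X⟧.- f , N , λ n N≤n → trans (-‿cong (f≈0 n N≤n)) -0#≈0#
      ; 0#  = R⟦X⟧.0# , 0 , λ _ _ → refl
      ; 1#  = constant 1# , constant-finite 1#
      ; isCommutativeRing = record
        { isRing = record
          { +-isAbelianGroup = record
            { isGroup = record
              { isMonoid = record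
                { isSemigroup = record
                  { isMagma = record
                    { isEquivalence = record
                      { refl  = λ n → refl
                      ; sym   = λ p≈q n → sym (p≈q n)
                      ; trans = λ p≈q q≈r n → trans (p≈q n) (q≈r n)
                      }
                    ; ∙-cong = R⟦X⟧.+-cong
                    }
                  ; assoc = λ p q r → R⟦X⟧.+-assoc (proj₁ p) (proj₁ q) (proj₁ r)
                  }
                ; identity = (λ p → R⟦X⟧.+-identityˡ (proj₁ p)) , (λ p → R⟦X⟧.+-identityʳ (proj₁ p))
                }
              ; inverse = (λ p → R⟦X⟧.-‿inverseˡ (proj₁ p)) , (λ p → R⟦X⟧.-‿inverseʳ (proj₁ p))
              ; ⁻¹-cong = R⟦X⟧.-‿cong
              }
            ; comm = λ p q → R⟦X⟧.+-comm (proj₁ p) (proj₁ q)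
            }
          ; *-cong     = R⟦X⟧.*-cong
          ; *-assoc    = λ p q r → R⟦X⟧.*-assoc (proj₁ p) (proj₁ q) (proj₁ r)
          ; *-identity = (λ p → R⟦X⟧.*-identityˡ (proj₁ p)) , (λ p → R⟦X⟧.*-identityʳ (proj₁ p))
          ; distrib    = (λ p q r → R⟦X⟧.distribˡ (proj₁ p) (proj₁ q) (proj₁ r))
                       , (λ p q r → R⟦X⟧.distribʳ (proj₁ p) (proj₁ q) (proj₁ r))
          }
        ; *-comm = λ p q → R⟦X⟧.*-comm (proj₁ p) (proj₁ q)
        }
      }

    X : CommutativeRing.Carrier commutativeRing
    X = indeterminate , 2 , λ { (suc (suc n)) _ → refl ; (suc zero) (s≤s ()) }

    scalar : Carrier → CommutativeRing.Carrier commutativeRing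
    scalar a = constant a , constant-finite a

    coefficient : CommutativeRing.Carrier commutativeRing → ℕ → Carrier
    coefficient = proj₁

  private
    module R[X] = Over commutativeRing

  opaque
    unfolding commutativeRing

    private
      regular-constant-term : ∀ {a} p → coefficient p 0 ≈ a → Regular a → R[X].Regular p
      regular-constant-term (f , _) f₀≈a a-reg = R[X].mkRegular λ (g , _) →
        regular-series f (Regular-cong (sym f₀≈a) a-reg) g

    regular-X : R[X].Regular X
    regular-X = R[X].mkRegular λ (g , _) → regular-indeterminate g

    regular-1+X : R[X].Regular (R[X].1# R[X].+ X)
    regular-1+X = regular-constant-term (R[X].1# R[X].+ X) (+-identityʳ 1#) Regular-1#

    regular-1+scalar : ∀ a → Regular (1# + a) → R[X].Regular (R[X].1# R[X].+ scalar a)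
    regular-1+scalar a = regular-constant-term (R[X].1# R[X].+ scalar a) refl

    regular-scalar+X : ∀ a → Regular a → R[X].Regular (scalar a R[X].+ X)
    regular-scalar+X a = regular-constant-term (scalar a R[X].+ X) (+-identityʳ a)

    regular-1+scalar*X : ∀ a → R[X].Regular (R[X].1# R[X].+ scalar a R[X].* X)
    regular-1+scalar*X a = regular-constant-term (R[X].1# R[X].+ scalar a R[X].* X)
      (trans (+-congˡ (trans (+-identityʳ _) (zeroʳ a))) (+-identityʳ 1#)) Regular-1#

ℚ[y] ℚ[y,t] ℚ⟨y,t⟩ ℚ[y]⟦t⟧ : CommutativeRing 0ℓ 0ℓ
ℚ[y]    = Polynomials.commutativeRing +-*-commutativeRing
ℚ[y,t]  = Polynomials.commutativeRing ℚ[y]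
ℚ⟨y,t⟩  = Fractions.commutativeRing ℚ[y,t]
ℚ[y]⟦t⟧ = PowerSeries.commutativeRing ℚ[y]

module RationalFunctions where

  open Over ℚ[y,t]
  open Fractions ℚ[y,t] public using (_/_∵_)
  private
    module Y = Polynomials +-*-commutativeRing
    module T = Polynomials ℚ[y]

  y t : Carrier
  y = T.scalar Y.X
  t = T.X

  regular-1 : Regular 1#
  regular-1 = Regular-1#

  regular-1+y : Regular (1# + y)
  regular-1+y = T.regular-1+scalar Y.X Y.regular-1+X

  regular-1+yt : Regular (1# + y * t)
  regular-1+yt = T.regular-1+scalar*X Y.X

  regular-y+t : Regular (y + t)
  regular-y+t = T.regular-scalar+X Y.X Y.regular-X

  regular-[y+t][1+yt] : Regular ((y + t) * (1# + y * t))
  regular-[y+t][1+yt] = Regular-* regular-y+t regular-1+yt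

module FormalPowerSeries where

  open Over ℚ[y]⟦t⟧
  open PowerSeries ℚ[y] public using (IsSqrt)

  y t : Carrier
  y = PowerSeries.scalar ℚ[y] (Polynomials.X +-*-commutativeRing)
  t = PowerSeries.X ℚ[y]

module Submission where

-- Give each letter of ∞π∞ a weight: 1 to a peak, e²YT to a valley, e to a
-- double ascent and eT to a double descent.  Since there are pk(π) peaks and
-- pk(π) + 1 valleys, the product of the weights of the n letters of π is
-- e^(n+1) Y^(pk(π)+1) T^(des(π)+1).  The map φ′ₓ exchanges the double ascent
-- and the double descent at x and changes the type of no other letter, so
-- pairing π with φ′ₓ(π) shows that the sum of these products over an invariant
-- set depends only on e²YT and e + eT.  Both identities compare two choices of
-- (e, Y, T) with the same e²YT and e + eT: in the first, (1, 1, t) with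
-- e = (1+yt)/(1+y), and in the second, (1, y, t) with (r, 1, v), where
-- r = (1+u)/(1+uv).

open import Defs
open import Algebra.Bundles using (CommutativeRing)
import Algebra.Properties.CommutativeSemigroup as CommutativeSemigroupProperties
import Algebra.Properties.Group as GroupProperties
import Algebra.Properties.Monoid.Sum as MonoidSum
import Algebra.Properties.Ring as RingProperties
import Algebra.Solver.Ring.NaturalCoefficients.Default as SemiringSolver
open import Data.Bool.Base using (Bool; true; false; not; _xor_; if_then_else_)
open import Data.Fin.Base as Fin using (Fin; zero; suc; toℕ; fromℕ<)
open import Data.Fin.Properties using (toℕ<n; toℕ-fromℕ<; toℕ≤pred[n])
open import Data.Fin.Subset using (⁅_⁆; ⊥)
open import Data.List.Base
  using (List; []; _∷_; _∷ʳ_; _++_; head; map; foldr; reverse; takeWhile; dropWhile;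
         null; upTo; allFin; length)
open import Data.List.Membership.Propositional using (_∈_)
open import Data.List.Membership.Propositional.Properties
  using (∈-∃++; ∈-map⁺; ∈-map⁻; ∈-applyUpTo⁺; ∈-applyUpTo⁻)
open import Data.List.Membership.Propositional.Properties.WithK using (unique∧set⇒bag)
open import Data.List.Properties
  using (++-assoc; foldr-map; length-map; length-upTo; map-tabulate; reverse-++;
         reverse-involutive; takeWhile++dropWhile; unfold-reverse)
open import Data.List.Relation.Binary.BagAndSetEquality using (∼bag⇒↭)
open import Data.List.Relation.Binary.Permutation.Propositional as Perm
  using (_↭_; ↭-sym; ↭⇒↭ₛ)
open import Data.List.Relation.Binary.Permutation.Propositional.Properties
  using (All-resp-↭; ∈-resp-↭; ↭-length; ↭-reverse)
import Data.List.Relation.Binary.Permutation.Setoid.Properties as Permutationₛ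
open import Data.List.Relation.Unary.All as All using (All; []; _∷_)
import Data.List.Relation.Unary.All.Properties as All
open import Data.List.Relation.Unary.AllPairs using ([]; _∷_)
open import Data.List.Relation.Unary.Any using (here; there)
open import Data.List.Relation.Unary.Unique.Propositional using (Unique)
import Data.List.Relation.Unary.Unique.Propositional.Properties as Unique
open import Data.Maybe.Base using (Maybe; just; nothing)
open import Data.Maybe.Relation.Unary.All as Maybe using (just; nothing)
open import Data.Nat.Base as ℕ
  using (ℕ; zero; suc; _≤_; _<_; _<ᵇ_; z≤n; s≤s; _∸_; _≤′_; ≤′-refl; ≤′-step)
import Data.Nat.Properties as ℕ
open import Data.Product.Base using (∃; _×_; _,_; proj₁; proj₂; Σ-syntax)
import Data.Rational.Base as ℚ
open import Data.Rational.Properties using (+-*-commutativeRing)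
open import Data.Sum.Base using (inj₁; inj₂)
import Data.Vec.Base as Vec
open import Function.Base using (_∘_; id)
open import Function.Bundles using (mk⇔)
open import Relation.Binary.Definitions using (tri<; tri≈; tri>)
open import Relation.Binary.PropositionalEquality as ≡ using (_≡_; _≢_; cong; cong₂; subst)
import Relation.Binary.Reasoning.Setoid as SetoidReasoning
open import Relation.Nullary.Decidable using (dec-true; dec-false; ¬?; does)
open import Relation.Nullary.Negation using (contradiction)
open import Relation.Unary using (Pred; Decidable; ∁)

-- Words between two neighbours, and their first and last letters.

-- A neighbour of a letter in ∞π∞ is an element of Maybe ℕ, nothing being ∞.
below : Maybe ℕ → ℕ → Bool
below nothing  a = false
below (just b) a = b <ᵇ a

first : List ℕ → Maybe ℕ → Maybe ℕ
first []      r = r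
first (a ∷ _) r = just a

final : Maybe ℕ → List ℕ → Maybe ℕ
final l []      = l
final l (a ∷ w) = final (just a) w

first-++ : ∀ u v r → first (u ++ v) r ≡ first u (first v r)
first-++ []      v r = ≡.refl
first-++ (_ ∷ _) v r = ≡.refl

final-∷ʳ : ∀ l w a → final l (w ∷ʳ a) ≡ just a
final-∷ʳ l []      a = ≡.refl
final-∷ʳ l (b ∷ w) a = final-∷ʳ (just b) w a

final-reverse : ∀ w → final nothing (reverse w) ≡ head w
final-reverse []      = ≡.refl
final-reverse (a ∷ w) = ≡.trans (cong (final nothing) (unfold-reverse a w)) (final-∷ʳ nothing (reverse w) a)

head-reverse : ∀ w → head (reverse w) ≡ final nothing w
head-reverse w = ≡.trans (≡.sym (final-reverse (reverse w))) (cong (final nothing) (reverse-involutive w))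

<⇒<ᵇ≡true : ∀ {a b} → a < b → (a <ᵇ b) ≡ true
<⇒<ᵇ≡true {a} {b} a<b = dec-true (a ℕ.<? b) a<b

≤⇒<ᵇ≡false : ∀ {a b} → b ≤ a → (a <ᵇ b) ≡ false
≤⇒<ᵇ≡false {a} {b} b≤a = dec-false (a ℕ.<? b) (ℕ.≤⇒≯ b≤a)

module _ {p} {A : Set} {Q : Pred A p} (Q? : Decidable Q) where

  takeWhile-++ : ∀ {xs ys} → All Q xs → Maybe.All (∁ Q) (head ys) → takeWhile Q? (xs ++ ys) ≡ xs
  takeWhile-++ {ys = []}     []         nothing   = ≡.refl
  takeWhile-++ {ys = y ∷ ys} []         (just ¬q) rewrite dec-false (Q? y) ¬q = ≡.refl
  takeWhile-++ {x ∷ xs}      (px ∷ pxs) ¬q        rewrite dec-true (Q? x) px =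
    cong (x ∷_) (takeWhile-++ pxs ¬q)

  dropWhile-++ : ∀ {xs ys} → All Q xs → Maybe.All (∁ Q) (head ys) → dropWhile Q? (xs ++ ys) ≡ ys
  dropWhile-++ {ys = []}     []         nothing   = ≡.refl
  dropWhile-++ {ys = y ∷ ys} []         (just ¬q) rewrite dec-false (Q? y) ¬q = ≡.refl
  dropWhile-++ {x ∷ xs}      (px ∷ pxs) ¬q        rewrite dec-true (Q? x) px = dropWhile-++ pxs ¬q

-- The x-factorization and the involution that exchanges `w₂` and `w₄`.

open Factorization

word : ℕ → Factorization → List ℕ
word x (factors w₁ w₂ w₄ w₅) = w₁ ++ w₂ ++ x ∷ w₄ ++ w₅

swap : Factorization → Factorization
swap (factors w₁ w₂ w₄ w₅) = factors w₁ w₄ w₂ w₅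

-- Freshness pins down the occurrence of `x`; `above₁` and `above₅` express the maximality of `w₂`
-- and `w₄`: the letter beyond each is larger than `x` or is ∞.
record IsFactorization (x : ℕ) (f : Factorization) : Set where
  field
    fresh₁ : All (_≢ x) (w₁ f)
    below₂ : All (_< x) (w₂ f)
    below₄ : All (_< x) (w₄ f)
    fresh₅ : All (_≢ x) (w₅ f)
    above₁ : Maybe.All (x <_) (final nothing (w₁ f))
    above₅ : Maybe.All (x <_) (head (w₅ f))

open IsFactorization

swap-isFactorization : ∀ {x f} → IsFactorization x f → IsFactorization x (swap f)
swap-isFactorization F = record
  { fresh₁ = fresh₁ F ; below₂ = below₄ F ; below₄ = below₂ F ; fresh₅ = fresh₅ F
  ; above₁ = above₁ F ; above₅ = above₅ F }

factorizationAround : ℕ → List ℕ → List ℕ → Factorization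
factorizationAround x u v = factors
  (reverse (dropWhile (ℕ._<? x) (reverse u)))
  (reverse (takeWhile (ℕ._<? x) (reverse u)))
  (takeWhile (ℕ._<? x) v)
  (dropWhile (ℕ._<? x) v)

-- As `x` does not occur in `u`, the search for it stops at the displayed occurrence.
factorization-around : ∀ x {u} v → All (_≢ x) u →
                       factorization x (u ++ x ∷ v) ≡ factorizationAround x u v
factorization-around x {u} v u≢x
  rewrite takeWhile-++ (¬? ∘ (ℕ._≟ x)) {u} {x ∷ v} u≢x (just λ x≢x → x≢x ≡.refl)
        | dropWhile-++ (¬? ∘ (ℕ._≟ x)) {u} {x ∷ v} u≢x (just λ x≢x → x≢x ≡.refl) = ≡.refl

word-around : ∀ x u v → word x (factorizationAround x u v) ≡ u ++ x ∷ v
word-around x u v = begin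
  reverse d ++ reverse t ++ x ∷ takeWhile (ℕ._<? x) v ++ dropWhile (ℕ._<? x) v
    ≡⟨ ++-assoc (reverse d) (reverse t) _ ⟨
  (reverse d ++ reverse t) ++ x ∷ takeWhile (ℕ._<? x) v ++ dropWhile (ℕ._<? x) v
    ≡⟨ cong₂ (λ a b → a ++ x ∷ b) (≡.sym (reverse-++ t d)) (takeWhile++dropWhile (ℕ._<? x) v) ⟩
  reverse (t ++ d) ++ x ∷ v
    ≡⟨ cong (λ a → reverse a ++ x ∷ v) (takeWhile++dropWhile (ℕ._<? x) (reverse u)) ⟩
  reverse (reverse u) ++ x ∷ v
    ≡⟨ cong (_++ x ∷ v) (reverse-involutive u) ⟩
  u ++ x ∷ v  ∎
  where
  open ≡.≡-Reasoning
  t d : List ℕ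
  t = takeWhile (ℕ._<? x) (reverse u)
  d = dropWhile (ℕ._<? x) (reverse u)

All-reverse : ∀ {p} {Q : Pred ℕ p} {w} → All Q w → All Q (reverse w)
All-reverse = All-resp-↭ (↭-sym (↭-reverse _))

≮∧≢⇒> : ∀ {x m} → Maybe.All (∁ (_< x)) m → Maybe.All (_≢ x) m → Maybe.All (x <_) m
≮∧≢⇒> nothing    nothing    = nothing
≮∧≢⇒> (just a≮x) (just a≢x) = just (ℕ.≤∧≢⇒< (ℕ.≮⇒≥ a≮x) (a≢x ∘ ≡.sym))

All-head : ∀ {p} {Q : Pred ℕ p} {w} → All Q w → Maybe.All Q (head w)
All-head []       = nothing
All-head (px ∷ _) = just px

-- `dropWhile` stops at a letter that is not below `x`; being different from `x`, that letter lies
-- above it.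
around-isFactorization : ∀ {x u v} → All (_≢ x) u → All (_≢ x) v →
                         IsFactorization x (factorizationAround x u v)
around-isFactorization {x} {u} {v} u≢x v≢x = record
  { fresh₁ = All-reverse d≢x
  ; below₂ = All-reverse (All.all-takeWhile (ℕ._<? x) (reverse u))
  ; below₄ = All.all-takeWhile (ℕ._<? x) v
  ; fresh₅ = All.dropWhile⁺ (ℕ._<? x) v≢x
  ; above₁ = subst (Maybe.All (x <_)) (≡.sym (final-reverse _))
               (≮∧≢⇒> (All.all-head-dropWhile (ℕ._<? x) (reverse u)) (All-head d≢x))
  ; above₅ = ≮∧≢⇒> (All.all-head-dropWhile (ℕ._<? x) v) (All-head (All.dropWhile⁺ (ℕ._<? x) v≢x))
  }
  where
  d≢x : All (_≢ x) (dropWhile (ℕ._<? x) (reverse u))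
  d≢x = All.dropWhile⁺ (ℕ._<? x) (All-reverse u≢x)

unique-around : ∀ {x : ℕ} u {v} → Unique (u ++ x ∷ v) → All (_≢ x) u × All (_≢ x) v
unique-around []      (x∉v ∷ _) = [] , All.map (_∘ ≡.sym) x∉v
unique-around (a ∷ u) (a∉ ∷ uniq) with unique-around u uniq
... | u≢x , v≢x with All.++⁻ʳ u a∉
...   | a≢x ∷ _ = a≢x ∷ u≢x , v≢x

factorize : ∀ {x w} → Unique w → x ∈ w → ∃ λ f → IsFactorization x f × w ≡ word x f
factorize {x} uniq x∈w with ∈-∃++ x∈w
... | u , v , ≡.refl with unique-around u uniq
...   | u≢x , v≢x = factorizationAround x u v , around-isFactorization u≢x v≢x , ≡.sym (word-around x u v)

-- The conditions determine the factorization: `w₂` and `w₄` lie below `x` and the letters beyond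
-- them do not, so the scans from `x` to either side stop exactly where these words end.
factorization-word : ∀ {x f} → IsFactorization x f → factorization x (word x f) ≡ f
factorization-word {x} {factors w₁ w₂ w₄ w₅} F = begin
  factorization x (w₁ ++ w₂ ++ x ∷ w₄ ++ w₅)
    ≡⟨ cong (factorization x) (++-assoc w₁ w₂ _) ⟨
  factorization x ((w₁ ++ w₂) ++ x ∷ w₄ ++ w₅)
    ≡⟨ factorization-around x (w₄ ++ w₅) (All.++⁺ (fresh₁ F) (All.map ℕ.<⇒≢ (below₂ F))) ⟩
  factorizationAround x (w₁ ++ w₂) (w₄ ++ w₅)
    ≡⟨ around-word ⟩
  factors w₁ w₂ w₄ w₅  ∎
  where
  open ≡.≡-Reasoning
  below₂ʳ : All (_< x) (reverse w₂)
  below₂ʳ = All-reverse (below₂ F)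
  ≮₁ : Maybe.All (∁ (_< x)) (head (reverse w₁))
  ≮₁ = subst (Maybe.All _) (≡.sym (head-reverse w₁)) (Maybe.map ℕ.<-asym (above₁ F))
  ≮₅ : Maybe.All (∁ (_< x)) (head w₅)
  ≮₅ = Maybe.map ℕ.<-asym (above₅ F)
  around-word : factorizationAround x (w₁ ++ w₂) (w₄ ++ w₅) ≡ factors w₁ w₂ w₄ w₅
  around-word
    rewrite reverse-++ w₁ w₂
          | takeWhile-++ (ℕ._<? x) below₂ʳ ≮₁
          | dropWhile-++ (ℕ._<? x) below₂ʳ ≮₁
          | takeWhile-++ (ℕ._<? x) (below₄ F) ≮₅
          | dropWhile-++ (ℕ._<? x) (below₄ F) ≮₅
          | reverse-involutive w₁
          | reverse-involutive w₂ = ≡.refl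

φ′-word : ∀ {x f} → IsFactorization x f →
          φ′ x (word x f) ≡ (if null (w₂ f) xor null (w₄ f) then word x (swap f) else word x f)
-- By definition `φ x` is `word x` of the swapped factorization, so only the computation of the
-- factorization remains.
φ′-word {x} {f} F = cong
  (λ g → if null (w₂ g) xor null (w₄ g) then word x (swap g) else word x f) (factorization-word F)

-- Swapping yields another factorization at `x`, again with exactly one of the two words empty, so a
-- second application swaps back; in the other cases nothing moves.
φ′-involutive : ∀ {x w} → Unique w → x ∈ w → φ′ x (φ′ x w) ≡ w
φ′-involutive {x} uniq x∈w with factorize uniq x∈w
... | factors _ []      []      _ , F , ≡.refl = ≡.trans (cong (φ′ x) (φ′-word F)) (φ′-word F)
... | factors _ []      (_ ∷ _) _ , F , ≡.refl = ≡.trans (cong (φ′ x) (φ′-word F)) (φ′-word (swap-isFactorization F))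
... | factors _ (_ ∷ _) []      _ , F , ≡.refl = ≡.trans (cong (φ′ x) (φ′-word F)) (φ′-word (swap-isFactorization F))
... | factors _ (_ ∷ _) (_ ∷ _) _ , F , ≡.refl = ≡.trans (cong (φ′ x) (φ′-word F)) (φ′-word F)

-- From subsets of letters to single letters.

foldr-id : ∀ {A B : Set} {f : A → B → B} → (∀ a b → f a b ≡ b) → ∀ b xs → foldr f b xs ≡ b
foldr-id f≡id b []       = ≡.refl
foldr-id f≡id b (x ∷ xs) = ≡.trans (f≡id x _) (foldr-id f≡id b xs)

lookup-⊥ : ∀ {n} (i : Fin n) → Vec.lookup ⊥ i ≡ false
lookup-⊥ zero    = ≡.refl
lookup-⊥ (suc i) = lookup-⊥ i

foldr-allFin-suc : ∀ {B : Set} {n} (f : Fin (suc n) → B → B) b →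
                   foldr f b (allFin (suc n)) ≡ f zero (foldr (f ∘ suc) b (allFin n))
foldr-allFin-suc {n = n} f b = cong (f zero) (≡.trans
  (cong (foldr f b) (≡.sym (map-tabulate {n = n} id Fin.suc)))
  (foldr-map f Fin.suc b (allFin n)))

-- Only the step at `i` is not the identity, the subset being `⊥` beyond it. This reduces invariance
-- to one letter at a time.
foldr-singleton : ∀ {B : Set} {n} (i : Fin n) (f : Fin n → B → B) b →
  foldr (λ j → if Vec.lookup ⁅ i ⁆ j then f j else id) b (allFin n) ≡ f i b
foldr-singleton zero f b = ≡.trans
  (foldr-allFin-suc (λ j → if Vec.lookup ⁅ zero ⁆ j then f j else id) b)
  (cong (f zero) (foldr-id
  (λ j c → cong (λ β → (if β then f (suc j) else id) c) (lookup-⊥ j)) b (allFin _)))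
foldr-singleton (suc i) f b = ≡.trans
  (foldr-allFin-suc (λ j → if Vec.lookup ⁅ suc i ⁆ j then f j else id) b)
  (foldr-singleton i (f ∘ suc) b)

φ′-∈ : ∀ {n} (Π : PermutationSet n) → Invariant Π → ∀ (i : Fin n) {w} →
       w ∈ words Π → φ′ (suc (toℕ i)) w ∈ words Π
φ′-∈ Π inv i {w} w∈Π = subst (_∈ words Π) (foldr-singleton i (φ′ ∘ suc ∘ toℕ) w) (inv w w∈Π ⁅ i ⁆)

module _ {n : ℕ} (Π : PermutationSet n) {w : List ℕ} (w∈Π : w ∈ words Π) where

  private
    w↭ : w ↭ [1⋯ n ]
    w↭ = All.lookup (permutations Π) w∈Π

  letters-unique : Unique w
  letters-unique = Permutationₛ.Unique-resp-↭ (≡.setoid ℕ) (↭⇒↭ₛ (↭-sym w↭))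
    (Unique.map⁺ ℕ.suc-injective (Unique.upTo⁺ n))

  letter-∈ : ∀ (i : Fin n) → suc (toℕ i) ∈ w
  letter-∈ i = ∈-resp-↭ (↭-sym w↭) (∈-map⁺ suc (∈-applyUpTo⁺ id (toℕ<n i)))

  letter-bounds : ∀ {a} → a ∈ w → 1 ≤ a × a ≤ n
  letter-bounds a∈w with ∈-map⁻ suc (∈-resp-↭ w↭ a∈w)
  ... | b , b∈ , ≡.refl with ∈-applyUpTo⁻ id b∈
  ...   | _ , b<n , ≡.refl = s≤s z≤n , b<n

  word-length : length w ≡ n
  word-length = ≡.trans (↭-length w↭) (≡.trans (length-map suc (upTo n)) (length-upTo n))

-- Involutions permute a list without repetitions.

unique-map : ∀ {A B : Set} {f : A → B} {xs} → (∀ {x y} → x ∈ xs → y ∈ xs → f x ≡ f y → x ≡ y) →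
             Unique xs → Unique (map f xs)
unique-map inj []            = []
unique-map inj (x∉xs ∷ uniq) =
  All.map⁺ (All.tabulate λ y∈xs fx≡fy → All.lookup x∉xs y∈xs (inj (here ≡.refl) (there y∈xs) fx≡fy))
  ∷ unique-map (λ x∈ y∈ → inj (there x∈) (there y∈)) uniq

-- Both lists are free of repetitions and have the same members, hence are equal as bags.
involution-↭ : ∀ {A : Set} (f : A → A) {xs} → Unique xs →
  (∀ {x} → x ∈ xs → f x ∈ xs) → (∀ {x} → x ∈ xs → f (f x) ≡ x) → map f xs ↭ xs
involution-↭ f {xs} uniq closed involutive =
  ∼bag⇒↭ (unique∧set⇒bag (unique-map injective uniq) uniq (mk⇔ to from))
  where
  injective : ∀ {x y} → x ∈ xs → y ∈ xs → f x ≡ f y → x ≡ y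
  injective x∈ y∈ fx≡fy = ≡.trans (≡.sym (involutive x∈)) (≡.trans (cong f fx≡fy) (involutive y∈))
  to : ∀ {x} → x ∈ map f xs → x ∈ xs
  to x∈ with ∈-map⁻ f x∈
  ... | y , y∈ , ≡.refl = closed y∈
  from : ∀ {x} → x ∈ xs → x ∈ map f xs
  from {x} x∈ = subst (_∈ map f xs) (involutive x∈) (∈-map⁺ f (closed x∈))

φ′-↭ : ∀ {n} (Π : PermutationSet n) → Invariant Π → ∀ (i : Fin n) →
       map (φ′ (suc (toℕ i))) (words Π) ↭ words Π
φ′-↭ Π inv i = involution-↭ _ (unique Π) (φ′-∈ Π inv i)
  (λ w∈Π → φ′-involutive (letters-unique Π w∈Π) (letter-∈ Π w∈Π i))

-- What a letter can tell about its neighbours.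

SameAt : Maybe ℕ → Maybe ℕ → ℕ → Set
SameAt m m′ a = below m a ≡ below m′ a

below-above : ∀ {x m a} → Maybe.All (x ≤_) m → a ≤ x → below m a ≡ false
below-above nothing    a≤x = ≡.refl
below-above (just x≤b) a≤x = ≤⇒<ᵇ≡false (ℕ.≤-trans a≤x x≤b)

-- A neighbour matters only through `below`, so a letter under `x` cannot distinguish neighbours
-- that are at least `x`, ∞ included.
same-above : ∀ {x m m′ a} → Maybe.All (x ≤_) m → Maybe.All (x ≤_) m′ →
             Maybe.All (_< x) a → Maybe.All (SameAt m m′) a
same-above x≤m x≤m′ = Maybe.map λ a<x →
  ≡.trans (below-above x≤m (ℕ.<⇒≤ a<x)) (≡.sym (below-above x≤m′ (ℕ.<⇒≤ a<x)))

same-below : ∀ {x b b′ a} → b ≤ x → b′ ≤ x → Maybe.All (x <_) a →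
             Maybe.All (SameAt (just b) (just b′)) a
same-below b≤x b′≤x = Maybe.map λ x<a →
  ≡.trans (<⇒<ᵇ≡true (ℕ.≤-<-trans b≤x x<a)) (≡.sym (<⇒<ᵇ≡true (ℕ.≤-<-trans b′≤x x<a)))

final-just : ∀ {p} {Q : Pred ℕ p} {b w} → Q b → All Q w → ∃ λ c → final (just b) w ≡ just c × Q c
final-just q []       = _ , ≡.refl , q
final-just _ (q ∷ qs) = final-just q qs

All-final : ∀ {p} {Q : Pred ℕ p} {w} → All Q w → Maybe.All Q (final nothing w)
All-final [] = nothing
All-final (q ∷ qs) with final-just q qs
... | _ , eq , q′ rewrite eq = just q′

-- Applied to `w₂`, this reads the left half of the type of `x` off the emptiness of the word;
-- `below-first` treats `w₄` and the right half.
below-final : ∀ {x l w} → Maybe.All (x ≤_) l → All (_< x) w → below (final l w) x ≡ not (null w)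
below-final x≤l []        = below-above x≤l ℕ.≤-refl
below-final x≤l (q ∷ qs) with final-just q qs
... | _ , eq , c<x rewrite eq = <⇒<ᵇ≡true c<x

first-nothing : ∀ w → first w nothing ≡ head w
first-nothing []      = ≡.refl
first-nothing (_ ∷ _) = ≡.refl

below-first : ∀ {x v w} → All (_< x) w → Maybe.All (x ≤_) (head v) →
              below (first (w ++ v) nothing) x ≡ not (null w)
below-first {v = v} [] x≤v rewrite first-nothing v = below-above x≤v ℕ.≤-refl
below-first (a<x ∷ _)  x≤v = <⇒<ᵇ≡true a<x

<ᵇ-flip : ∀ {a b} → a ≢ b → (b <ᵇ a) ≡ not (a <ᵇ b)
<ᵇ-flip {a} {b} a≢b with ℕ.<-cmp a b
... | tri< a<b _ _ rewrite <⇒<ᵇ≡true a<b = ≤⇒<ᵇ≡false (ℕ.<⇒≤ a<b)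
... | tri≈ _ a≡b _ = contradiction a≡b a≢b
... | tri> _ _ b<a rewrite <⇒<ᵇ≡true b<a | ≤⇒<ᵇ≡false (ℕ.<⇒≤ b<a) = ≡.refl

-- Without a smaller letter before it, `b` is no peak, and the first letter of a word never counts
-- as one.
pk-descent : ∀ a b w → (a <ᵇ b) ≡ false → pk (a ∷ b ∷ w) ≡ pk (b ∷ w)
pk-descent a b []      eq = ≡.refl
pk-descent a b (d ∷ w) eq rewrite eq = ≡.refl

-- Products of letter weights, and their change under the involutions.

module LetterWeights {c ℓ} (R : CommutativeRing c ℓ) where

  open Over R
  open CommutativeSemigroupProperties +-commutativeSemigroup using (interchange; x∙yz≈y∙xz)
  open SetoidReasoning setoid
  open SemiringSolver commutativeSemiring using (solve; _:=_; _:*_; _:+_; con)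

  -- The arguments tell whether the left and the right neighbour are smaller: `true true` is a peak,
  -- `false false` a valley, `true false` a double ascent and `false true` a double descent.
  Weight : Set c
  Weight = Bool → Bool → Carrier

  _≋_ : Weight → Weight → Set ℓ
  p ≋ q = ∀ L R → p L R ≈ q L R

  -- `l` and `r` are the neighbours of the whole word. The weight may vary with the letter, so that
  -- weights can be replaced one letter at a time.
  weight : (ℕ → Weight) → Maybe ℕ → List ℕ → Maybe ℕ → Carrier
  weight g l []      r = 1#
  weight g l (a ∷ w) r = g a (below l a) (below (first w r) a) * weight g (just a) w r

  weight-++ : ∀ g l u v r → weight g l (u ++ v) r ≈ weight g l u (first v r) * weight g (final l u) v r
  weight-++ g l []      v r = sym (*-identityˡ _)
  weight-++ g l (a ∷ u) v r rewrite first-++ u v r =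
    trans (*-congˡ (weight-++ g (just a) u v r)) (sym (*-assoc _ _ _))

  -- Only the first letter sees `l`, and only the last one sees `r`.
  weight-cong : ∀ {g g′ l l′ r r′ w} → All (λ a → g a ≋ g′ a) w →
                Maybe.All (SameAt l l′) (head w) → Maybe.All (SameAt r r′) (final nothing w) →
                weight g l w r ≈ weight g′ l′ w r′
  weight-cong {w = []}        []         _        _        = refl
  weight-cong {w = a ∷ []}    (ga ∷ _)   (just l) (just r) rewrite l | r = *-congʳ (ga _ _)
  weight-cong {w = a ∷ b ∷ w} (ga ∷ gs)  (just l) r        rewrite l =
    *-cong (ga _ _) (weight-cong gs (just ≡.refl) r)

  same : ∀ m {a} → Maybe.All (SameAt m m) a
  same m {just _}  = just ≡.refl
  same m {nothing} = nothing

  weight-congʷ : ∀ {g g′ l r w} → All (λ a → g a ≋ g′ a) w → weight g l w r ≈ weight g′ l w r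
  weight-congʷ {l = l} {r} gs = weight-cong gs (same l) (same r)

  total : (ℕ → Weight) → List ℕ → Carrier
  total g w = weight g nothing w nothing

  -- The contribution of all letters but `x`, in a form symmetric in `w₂` and `w₄`.
  others : (ℕ → Weight) → ℕ → Factorization → Carrier
  others g x (factors w₁ w₂ w₄ w₅) =
    weight g nothing w₁ (just x) * ((total g w₂ * total g w₄) * weight g (just x) w₅ nothing)

  others-swap : ∀ g x f → others g x (swap f) ≈ others g x f
  others-swap g x f = *-congˡ (*-congʳ (*-comm _ _))

  others-cong : ∀ {g g′ x f} → IsFactorization x f → (∀ a → a ≢ x → g a ≋ g′ a) →
                others g x f ≈ others g′ x f
  others-cong {g} {g′} {x} F g≋g′ = *-cong (congʷ (fresh₁ F))
    (*-cong (*-cong (congʷ (All.map ℕ.<⇒≢ (below₂ F))) (congʷ (All.map ℕ.<⇒≢ (below₄ F))))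
            (congʷ (fresh₅ F)))
    where
    congʷ : ∀ {l r w} → All (_≢ x) w → weight g l w r ≈ weight g′ l w r
    congʷ w≢x = weight-congʷ (All.map (λ {a} → g≋g′ a) w≢x)

  -- The letters around w₂ and w₄ exceed all their letters, so these words
  -- may as well stand between infinities, wherever they are placed.
  total-word : ∀ g {x f} → IsFactorization x f →
               total g (word x f) ≈ g x (not (null (w₂ f))) (not (null (w₄ f))) * others g x f
  total-word g {x} {f@(factors w₁ w₂ w₄ w₅)} F = begin
    total g (w₁ ++ w₂ ++ x ∷ w₄ ++ w₅)
      ≈⟨ weight-++ g nothing w₁ _ nothing ⟩
    weight g nothing w₁ (first (w₂ ++ x ∷ w₄ ++ w₅) nothing) * weight g l (w₂ ++ x ∷ w₄ ++ w₅) nothing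
      ≈⟨ *-cong weight₁ (begin
        weight g l (w₂ ++ x ∷ w₄ ++ w₅) nothing
          ≈⟨ weight-++ g l w₂ _ nothing ⟩
        weight g l w₂ (just x) * (g x (below (final l w₂) x) (below (first (w₄ ++ w₅) nothing) x)
                                    * weight g (just x) (w₄ ++ w₅) nothing)
          ≈⟨ *-cong weight₂ (*-cong weightₓ (begin
            weight g (just x) (w₄ ++ w₅) nothing
              ≈⟨ weight-++ g (just x) w₄ w₅ nothing ⟩
            weight g (just x) w₄ (first w₅ nothing) * weight g (final (just x) w₄) w₅ nothing
              ≈⟨ *-cong weight₄ weight₅ ⟩
            total g w₄ * weight g (just x) w₅ nothing ∎)) ⟩
        total g w₂ * (gₓ * (total g w₄ * weight g (just x) w₅ nothing)) ∎) ⟩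
    weight g nothing w₁ (just x) * (total g w₂ * (gₓ * (total g w₄ * weight g (just x) w₅ nothing)))
      ≈⟨ solve 5 (λ a b d e k → a :* (b :* (k :* (d :* e))) := k :* (a :* ((b :* d) :* e))) refl
           (weight g nothing w₁ (just x)) (total g w₂) (total g w₄) (weight g (just x) w₅ nothing) gₓ ⟩
    gₓ * others g x f ∎
    where
    l : Maybe ℕ
    l = final nothing w₁

    gₓ : Carrier
    gₓ = g x (not (null w₂)) (not (null w₄))

    x≤l : Maybe.All (x ≤_) l
    x≤l = Maybe.map ℕ.<⇒≤ (above₁ F)

    x≤r : Maybe.All (x ≤_) (head w₅)
    x≤r = Maybe.map ℕ.<⇒≤ (above₅ F)

    reflexive≋ : ∀ w → All (λ a → g a ≋ g a) w
    reflexive≋ w = All.universal (λ _ _ _ → refl) w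

    -- The last letter of `w₁` exceeds `x` and the first letter of `w₂` alike, so either may follow
    -- it.
    weight₁ : weight g nothing w₁ (first (w₂ ++ x ∷ w₄ ++ w₅) nothing) ≈ weight g nothing w₁ (just x)
    weight₁ = weight-cong (reflexive≋ w₁) (same nothing) (flank (below₂ F))
      where
      flank : ∀ {w} → All (_< x) w → Maybe.All (SameAt (first (w ++ x ∷ w₄ ++ w₅) nothing) (just x)) l
      flank []        = same (just x)
      flank (a<x ∷ _) = same-below (ℕ.<⇒≤ a<x) ℕ.≤-refl (above₁ F)

    weight₂ : weight g l w₂ (just x) ≈ total g w₂
    weight₂ = weight-cong (reflexive≋ w₂)
      (same-above x≤l nothing (All-head (below₂ F)))
      (same-above (just ℕ.≤-refl) nothing (All-final (below₂ F)))

    weightₓ : g x (below (final l w₂) x) (below (first (w₄ ++ w₅) nothing) x) ≈ gₓ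
    weightₓ = reflexive (cong₂ (g x) (below-final x≤l (below₂ F)) (below-first (below₄ F) x≤r))

    weight₄ : weight g (just x) w₄ (first w₅ nothing) ≈ total g w₄
    weight₄ rewrite first-nothing w₅ = weight-cong (reflexive≋ w₄)
      (same-above (just ℕ.≤-refl) nothing (All-head (below₄ F)))
      (same-above x≤r nothing (All-final (below₄ F)))

    weight₅ : weight g (final (just x) w₄) w₅ nothing ≈ weight g (just x) w₅ nothing
    -- The letter before `w₅` is `x` itself when `w₄` is empty and smaller otherwise; `c ≤ x` covers
    -- both cases.
    weight₅ with final-just ℕ.≤-refl (All.map ℕ.<⇒≤ (below₄ F))
    ... | c , eq , c≤x rewrite eq =
      weight-cong (reflexive≋ w₅) (same-below c≤x ℕ.≤-refl (above₅ F)) (same nothing)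

  -- Peaks and valleys stay where they are while the two slopes are exchanged, so only the sum of
  -- the slope weights has to agree.
  record _≃_ (p q : Weight) : Set ℓ where
    field
      peak   : p true true ≈ q true true
      valley : p false false ≈ q false false
      slopes : p true false + p false true ≈ q true false + q false true

  open _≃_

  -- If `x` is a peak or a valley, the word is fixed and each summand is preserved. Otherwise the
  -- two words share the factor `others`, which multiplies the sum of the slope weights of `x`.
  total-φ′ : ∀ {g g′ x w} → Unique w → x ∈ w → (∀ a → a ≢ x → g a ≋ g′ a) → g x ≃ g′ x →
             total g w + total g (φ′ x w) ≈ total g′ w + total g′ (φ′ x w)
  total-φ′ {g} {g′} {x} uniq x∈w g≋g′ gx≃g′x with factorize uniq x∈w
  ... | f , F , ≡.refl rewrite φ′-word F = pair f F
    where
    fixed : ∀ {f} → IsFactorization x f →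
            g x (not (null (w₂ f))) (not (null (w₄ f))) ≈ g′ x (not (null (w₂ f))) (not (null (w₄ f))) →
            total g (word x f) ≈ total g′ (word x f)
    fixed F eq = trans (total-word g F) (trans (*-cong eq (others-cong F g≋g′)) (sym (total-word g′ F)))

    both : ∀ h {f} → IsFactorization x f →
           total h (word x f) + total h (word x (swap f)) ≈
           (h x (not (null (w₂ f))) (not (null (w₄ f))) + h x (not (null (w₄ f))) (not (null (w₂ f))))
             * others h x f
    both h {f} F = trans
      (+-cong (total-word h F)
              (trans (total-word h (swap-isFactorization F)) (*-congˡ (others-swap h x f))))
      (sym (distribʳ _ _ _))

    moved : ∀ {f} → IsFactorization x f →
      g x (not (null (w₂ f))) (not (null (w₄ f))) + g x (not (null (w₄ f))) (not (null (w₂ f))) ≈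
      g′ x (not (null (w₂ f))) (not (null (w₄ f))) + g′ x (not (null (w₄ f))) (not (null (w₂ f))) →
      total g (word x f) + total g (word x (swap f)) ≈ total g′ (word x f) + total g′ (word x (swap f))
    moved F eq = trans (both g F) (trans (*-cong eq (others-cong F g≋g′)) (sym (both g′ F)))

    pair : ∀ f → IsFactorization x f →
      let w′ = if null (w₂ f) xor null (w₄ f) then word x (swap f) else word x f
      in total g (word x f) + total g w′ ≈ total g′ (word x f) + total g′ w′
    pair (factors _ []      []      _) F = +-cong (fixed F (valley gx≃g′x)) (fixed F (valley gx≃g′x))
    -- Here `x` is a double descent in the first word and a double ascent in the second, the reverse
    -- of the order in `slopes`.
    pair (factors _ []      (_ ∷ _) _) F =
      moved F (trans (+-comm _ _) (trans (slopes gx≃g′x) (+-comm _ _)))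
    pair (factors _ (_ ∷ _) []      _) F = moved F (slopes gx≃g′x)
    pair (factors _ (_ ∷ _) (_ ∷ _) _) F = +-cong (fixed F (peak gx≃g′x)) (fixed F (peak gx≃g′x))

  -- Sums over an invariant set of permutations.

  Σ[_] : List (List ℕ) → (List ℕ → Carrier) → Carrier
  Σ[ ws ] f = foldr (λ w s → f w + s) 0# ws

  Σ-cong : ∀ {f f′} ws → (∀ {w} → w ∈ ws → f w ≈ f′ w) → Σ[ ws ] f ≈ Σ[ ws ] f′
  Σ-cong []       eq = refl
  Σ-cong (w ∷ ws) eq = +-cong (eq (here ≡.refl)) (Σ-cong ws (eq ∘ there))

  Σ-+ : ∀ f f′ ws → Σ[ ws ] f + Σ[ ws ] f′ ≈ Σ[ ws ] (λ w → f w + f′ w)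
  Σ-+ f f′ []       = +-identityˡ 0#
  Σ-+ f f′ (w ∷ ws) = trans (interchange _ _ _ _) (+-congˡ (Σ-+ f f′ ws))

  Σ-* : ∀ a f ws → a * Σ[ ws ] f ≈ Σ[ ws ] (λ w → a * f w)
  Σ-* a f []       = zeroʳ a
  Σ-* a f (w ∷ ws) = trans (distribˡ _ _ _) (+-congˡ (Σ-* a f ws))

  Σ-map : ∀ f h ws → Σ[ map h ws ] f ≡ Σ[ ws ] (f ∘ h)
  Σ-map f h []       = ≡.refl
  Σ-map f h (w ∷ ws) = cong (f (h w) +_) (Σ-map f h ws)

  Σ-↭ : ∀ f {us vs} → us ↭ vs → Σ[ us ] f ≈ Σ[ vs ] f
  Σ-↭ f Perm.refl         = refl
  Σ-↭ f (Perm.prep w p)   = +-congˡ (Σ-↭ f p)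
  Σ-↭ f (Perm.swap v w p) = trans (x∙yz≈y∙xz _ _ _) (+-congˡ (+-congˡ (Σ-↭ f p)))
  Σ-↭ f (Perm.trans p q)  = trans (Σ-↭ f p) (Σ-↭ f q)

  module _ {½ : Carrier} (½+½≈1 : ½ + ½ ≈ 1#) where

    halve : ∀ {a b} → a + a ≈ b + b → a ≈ b
    halve {a} {b} eq = trans (sym (half a)) (trans (*-congˡ eq) (half b))
      where
      half : ∀ a → ½ * (a + a) ≈ a
      half a = trans (solve 2 (λ h a → h :* (a :+ a) := (h :+ h) :* a) refl ½ a)
                     (trans (*-congʳ ½+½≈1) (*-identityˡ a))

    module _ {n} (Π : PermutationSet n) (inv : Invariant Π) where

      -- As the involution at this letter permutes the set, twice the sum is a sum of pairs, to
      -- which `total-φ′` applies; the factor 2 is then cancelled.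
      Σ-letter : ∀ {g g′} (i : Fin n) → (∀ a → a ≢ suc (toℕ i) → g a ≋ g′ a) →
                 g (suc (toℕ i)) ≃ g′ (suc (toℕ i)) →
                 Σ[ words Π ] (total g) ≈ Σ[ words Π ] (total g′)
      Σ-letter {g} {g′} i g≋g′ gx≃g′x = halve (begin
        Σ[ words Π ] (total g) + Σ[ words Π ] (total g)
          ≈⟨ double g ⟩
        Σ[ words Π ] (λ w → total g w + total g (φ′ x w))
          ≈⟨ Σ-cong (words Π) (λ w∈Π →
               total-φ′ (letters-unique Π w∈Π) (letter-∈ Π w∈Π i) g≋g′ gx≃g′x) ⟩
        Σ[ words Π ] (λ w → total g′ w + total g′ (φ′ x w))
          ≈⟨ double g′ ⟨
        Σ[ words Π ] (total g′) + Σ[ words Π ] (total g′) ∎)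
        where
        x : ℕ
        x = suc (toℕ i)

        double : ∀ h → Σ[ words Π ] (total h) + Σ[ words Π ] (total h) ≈
                       Σ[ words Π ] (λ w → total h w + total h (φ′ x w))
        double h = begin
          Σ[ words Π ] (total h) + Σ[ words Π ] (total h)
            ≈⟨ +-congˡ (Σ-↭ (total h) (φ′-↭ Π inv i)) ⟨
          Σ[ words Π ] (total h) + Σ[ map (φ′ x) (words Π) ] (total h)
            ≡⟨ cong (Σ[ words Π ] (total h) +_) (Σ-map (total h) (φ′ x) (words Π)) ⟩
          Σ[ words Π ] (total h) + Σ[ words Π ] (total h ∘ φ′ x)
            ≈⟨ Σ-+ (total h) (total h ∘ φ′ x) (words Π) ⟩
          Σ[ words Π ] (λ w → total h w + total h (φ′ x w)) ∎

      -- `hybrid k` gives weight `q` to the letters up to `k` and `p` to the others. Since the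
      -- letters are 1 to `n`, it runs from `p` at `k = 0` to `q` at `k = n`, changing one letter
      -- per step.
      Σ-uniform : ∀ {p q} → p ≃ q → Σ[ words Π ] (total (λ _ → p)) ≈ Σ[ words Π ] (total (λ _ → q))
      Σ-uniform {p} {q} p≃q = begin
        Σ[ words Π ] (total (λ _ → p))
          ≈⟨ Σ-cong (words Π) (λ w∈Π → weight-congʷ (All.tabulate (λ a∈w _ _ →
               reflexive (cong (λ g → g _ _) (≡.sym (hybrid-> (proj₁ (letter-bounds Π w∈Π a∈w)))))))) ⟩
        Σ[ words Π ] (total (hybrid 0))
          ≈⟨ Σ-hybrid n ℕ.≤-refl ⟩
        Σ[ words Π ] (total (hybrid n))
          ≈⟨ Σ-cong (words Π) (λ w∈Π → weight-congʷ (All.tabulate (λ a∈w _ _ →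
               reflexive (cong (λ g → g _ _) (hybrid-≤ (proj₂ (letter-bounds Π w∈Π a∈w))))))) ⟩
        Σ[ words Π ] (total (λ _ → q)) ∎
        where
        hybrid : ℕ → ℕ → Weight
        hybrid k a = if does (a ℕ.≤? k) then q else p

        hybrid-≤ : ∀ {k a} → a ≤ k → hybrid k a ≡ q
        hybrid-≤ {k} {a} a≤k rewrite dec-true (a ℕ.≤? k) a≤k = ≡.refl

        hybrid-> : ∀ {k a} → k < a → hybrid k a ≡ p
        hybrid-> {k} {a} k<a rewrite dec-false (a ℕ.≤? k) (ℕ.<⇒≱ k<a) = ≡.refl

        hybrid-step : ∀ k a → a ≢ suc k → hybrid k a ≡ hybrid (suc k) a
        hybrid-step k a a≢1+k with ℕ.≤-total a k
        ... | inj₁ a≤k = ≡.trans (hybrid-≤ a≤k) (≡.sym (hybrid-≤ (ℕ.m≤n⇒m≤1+n a≤k)))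
        ... | inj₂ k≤a with ℕ.m≤n⇒m<n∨m≡n k≤a
        ...   | inj₁ k<a = ≡.trans (hybrid-> k<a) (≡.sym (hybrid-> (ℕ.≤∧≢⇒< k<a (a≢1+k ∘ ≡.sym))))
        ...   | inj₂ ≡.refl = ≡.trans (hybrid-≤ {k} ℕ.≤-refl) (≡.sym (hybrid-≤ (ℕ.n≤1+n k)))

        Σ-hybrid : ∀ k → k ≤ n → Σ[ words Π ] (total (hybrid 0)) ≈ Σ[ words Π ] (total (hybrid k))
        Σ-hybrid zero    _   = refl
        -- The letter whose weight changes is `suc k`, which is represented by the element `k` of
        -- `Fin n`.
        Σ-hybrid (suc k) k<n = trans (Σ-hybrid k (ℕ.<⇒≤ k<n)) (Σ-letter (fromℕ< k<n) step at)
          where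
          step : ∀ a → a ≢ suc (toℕ (fromℕ< k<n)) → hybrid k a ≋ hybrid (suc k) a
          step a a≢ _ _ rewrite toℕ-fromℕ< k<n = reflexive (cong (λ g → g _ _) (hybrid-step k a a≢))

          at : hybrid k (suc (toℕ (fromℕ< k<n))) ≃ hybrid (suc k) (suc (toℕ (fromℕ< k<n)))
          at rewrite toℕ-fromℕ< k<n | hybrid-> {k} {suc k} ℕ.≤-refl | hybrid-≤ {suc k} {suc k} ℕ.≤-refl = p≃q

  -- The weights that record peaks and descents.

  module _ (e Y T : Carrier) where

    pkdes : Weight
    pkdes true  true  = 1#
    pkdes true  false = e
    pkdes false true  = e * T
    pkdes false false = e * e * (Y * T)

    private
      monomial : ℕ → ℕ → ℕ → Carrier
      monomial i j k = e ^ i * (Y ^ j * T ^ k)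

      -- The exponent of `e` is the number of letters plus valleys minus peaks, that of `Y` counts
      -- valleys, and that of `T` counts letters entered by a descent. Entered by an ascent and left
      -- towards ∞, a word has as many valleys as peaks; `p` is kept in `pk` because `a` may be a
      -- peak.
      inside : ∀ p a w → (p <ᵇ a) ≡ true → Unique (a ∷ w) →
               weight (λ _ → pkdes) (just p) (a ∷ w) nothing ≈
               monomial (length (a ∷ w)) (pk (p ∷ a ∷ w)) (des (a ∷ w))

      -- Entered by a descent or from ∞, a word has one valley more than it has peaks, and the entry
      -- itself adds one factor `T`.
      outside : ∀ l a w → below l a ≡ false → Unique (a ∷ w) →
                weight (λ _ → pkdes) l (a ∷ w) nothing ≈
                monomial (suc (length (a ∷ w))) (suc (pk (a ∷ w))) (suc (des (a ∷ w)))

      inside p a [] p<a uniq rewrite p<a =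
        solve 1 (λ e → e :* con 1 := (e :* con 1) :* (con 1 :* con 1)) refl e
      -- The comparison of `a` with `b` decides whether the rest is entered by an ascent or by a
      -- descent.
      inside p a (b ∷ w) p<a ((a≢b ∷ _) ∷ uniq) with a <ᵇ b in a<b | <ᵇ-flip a≢b | inside a b w | outside (just a) b w
      ... | true  | b≮a | in-b | _ rewrite p<a | b≮a = trans (*-congˡ (in-b ≡.refl uniq))
        (solve 3 (λ e m n → e :* (m :* n) := (e :* m) :* n) refl e _ _)
      -- `a` is a peak of weight 1; the three increments in `outside` account for the letter `a`,
      -- the peak at `a` and the descent after it.
      ... | false | b<a | _ | out-b rewrite p<a | b<a = trans (*-congˡ (out-b ≡.refl uniq)) 
        (trans (*-identityˡ _) (reflexive (cong (λ j → monomial (suc (suc (length w))) (suc j) (suc (des (b ∷ w)))) (≡.sym (pk-descent a b w a<b)))))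

      outside l a [] l≮a uniq rewrite l≮a =
        solve 3 (λ e y t → ((e :* e) :* (y :* t)) :* con 1 :=
                           (e :* (e :* con 1)) :* ((y :* con 1) :* (t :* con 1))) refl e Y T
      outside l a (b ∷ w) l≮a ((a≢b ∷ _) ∷ uniq) with a <ᵇ b in a<b | <ᵇ-flip a≢b | inside a b w | outside (just a) b w
      ... | true  | b≮a | in-b | _ rewrite l≮a | b≮a = trans (*-congˡ (in-b ≡.refl uniq))
        (solve 6 (λ e y t m j k → ((e :* e) :* (y :* t)) :* (m :* (j :* k)) :=
                                  (e :* (e :* m)) :* ((y :* j) :* (t :* k))) refl e Y T _ _ _)
      ... | false | b<a | _ | out-b rewrite l≮a | b<a | pk-descent a b w a<b = trans (*-congˡ (out-b ≡.refl uniq))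
        (solve 5 (λ e t m j k → (e :* t) :* (m :* (j :* k)) :=
                                (e :* m) :* (j :* (t :* k))) refl e T _ _ _)

    total-pkdes : ∀ {n w} → 1 ≤ n → length w ≡ n → Unique w →
                  total (λ _ → pkdes) w ≈ e ^ suc n * (Y ^ suc (pk w) * T ^ suc (des w))
    -- The empty word has total 1, whereas the formula would give `e * (Y * T)`.
    total-pkdes {w = []}    ()  ≡.refl _
    total-pkdes {w = a ∷ w} 1≤n ≡.refl uniq = outside nothing a w ≡.refl uniq

    Σ-pkdes : ∀ {n} → 1 ≤ n → (Π : PermutationSet n) →
              Σ[ words Π ] (total (λ _ → pkdes)) ≈ e ^ suc n * P Π Y T
    Σ-pkdes 1≤n Π = trans
      (Σ-cong (words Π) (λ w∈Π → total-pkdes 1≤n (word-length Π w∈Π) (letters-unique Π w∈Π)))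
      (sym (Σ-* _ _ (words Π)))

  -- Transformation formulas for `P` and `A`.

  P-transform : ∀ {½} → ½ + ½ ≈ 1# → ∀ {n} → 1 ≤ n → (Π : PermutationSet n) → Invariant Π →
    ∀ {e Y T e′ Y′ T′} → e * e * (Y * T) ≈ e′ * e′ * (Y′ * T′) → e + e * T ≈ e′ + e′ * T′ →
    e ^ suc n * P Π Y T ≈ e′ ^ suc n * P Π Y′ T′
  P-transform ½+½≈1 {n} 1≤n Π inv {e} {Y} {T} {e′} {Y′} {T′} valleys slopes = begin
    e ^ suc n * P Π Y T                         ≈⟨ Σ-pkdes e Y T 1≤n Π ⟨
    Σ[ words Π ] (total (λ _ → pkdes e Y T))    ≈⟨ Σ-uniform ½+½≈1 Π inv (record
                                                     { peak = refl ; valley = valleys ; slopes = slopes }) ⟩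
    Σ[ words Π ] (total (λ _ → pkdes e′ Y′ T′)) ≈⟨ Σ-pkdes e′ Y′ T′ 1≤n Π ⟩
    e′ ^ suc n * P Π Y′ T′                      ∎

  1^n≈1 : ∀ n → 1# ^ n ≈ 1#
  1^n≈1 zero    = refl
  1^n≈1 (suc n) = trans (*-identityˡ _) (1^n≈1 n)

  P-1 : ∀ {n} (Π : PermutationSet n) t → P Π 1# t ≈ A Π t
  P-1 Π t = Σ-cong (words Π) λ {w} _ → trans (*-congʳ (1^n≈1 (suc (pk w)))) (*-identityˡ _)

  -- One side is taken at `e = Y = 1`, where `P` becomes `A`.
  A-transform : ∀ {½} → ½ + ½ ≈ 1# → ∀ {n} → 1 ≤ n → (Π : PermutationSet n) → Invariant Π →
    ∀ {t e Y T} → t ≈ e * e * (Y * T) → 1# + t ≈ e + e * T → A Π t ≈ e ^ suc n * P Π Y T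
  A-transform ½+½≈1 {n} 1≤n Π inv {t} {e} {Y} {T} valleys slopes = begin
    A Π t                     ≈⟨ P-1 Π t ⟨
    P Π 1# t                  ≈⟨ *-identityˡ _ ⟨
    1# * P Π 1# t             ≈⟨ *-congʳ (1^n≈1 (suc n)) ⟨
    1# ^ suc n * P Π 1# t     ≈⟨ P-transform ½+½≈1 1≤n Π inv
                                   (trans (solve 1 (λ t → con 1 :* con 1 :* (con 1 :* t) := t) refl t) valleys)
                                   (trans (+-congˡ (*-identityˡ t)) slopes) ⟩
    e ^ suc n * P Π Y T       ∎

-- One half as a constant series and as a constant polynomial.

module Halves {c ℓ} (R : CommutativeRing c ℓ) where

  open Over R

  Half : Carrier → Set ℓ
  Half h = h + h ≈ 1#

  opaque
    unfolding PowerSeries.commutativeRing Polynomials.commutativeRing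

    scalar-half-series : ∀ {h} → Half h →
      (let open CommutativeRing (PowerSeries.commutativeRing R) renaming (_+_ to _⊕_; _≈_ to _≃_; 1# to 1′)
       in  (PowerSeries.scalar R h ⊕ PowerSeries.scalar R h) ≃ 1′)
    scalar-half-series h+h≈1 zero    = h+h≈1
    scalar-half-series h+h≈1 (suc n) = +-identityˡ 0#

    scalar-half-polynomial : ∀ {h} → Half h →
      (let open CommutativeRing (Polynomials.commutativeRing R) renaming (_+_ to _⊕_; _≈_ to _≃_; 1# to 1′)
       in  (Polynomials.scalar R h ⊕ Polynomials.scalar R h) ≃ 1′)
    scalar-half-polynomial h+h≈1 zero    = h+h≈1
    scalar-half-polynomial h+h≈1 (suc n) = +-identityˡ 0#

-- Power series solutions of q = 1 + X (a q + b q²), and regular series.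

module FixedPoint {c ℓ} (R : CommutativeRing c ℓ) where

  open Over R
  open PowerSeries R
  open MonoidSum +-monoid using (sum-cong-≋)
  private
    module R⟦X⟧ = Over commutativeRing

  infix 4 _≈[≤_]_

  _≈[≤_]_ : Series → ℕ → Series → Set ℓ
  f ≈[≤ n ] g = ∀ i → i ≤ n → f i ≈ g i

  ⊛-local : ∀ {f f′ g g′ n} → f ≈[≤ n ] f′ → g ≈[≤ n ] g′ → (f ⊛ g) ≈[≤ n ] (f′ ⊛ g′)
  ⊛-local f≈ g≈ i i≤n = sum-cong-≋ {suc i} λ j →
    *-cong (f≈ (toℕ j) (ℕ.≤-trans (toℕ≤pred[n] j) i≤n)) (g≈ (i ∸ toℕ j) (ℕ.≤-trans (ℕ.m∸n≤m i (toℕ j)) i≤n))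

  module _ (a b : Series) where

    step : Series → Series
    step f n = (a ⊛ f) n + (b ⊛ (f ⊛ f)) n

    step-local : ∀ {f g n} → f ≈[≤ n ] g → step f ≈[≤ n ] step g
    step-local f≈g i i≤n =
      +-cong (⊛-local {a} (λ _ _ → refl) f≈g i i≤n)
             (⊛-local {b} (λ _ _ → refl) (⊛-local f≈g f≈g) i i≤n)

    -- Iterates of f ↦ 1 + X `step f`, starting from the constant 1.
    approximant : ℕ → Series
    approximant k       zero    = 1#
    approximant zero    (suc n) = 0#
    approximant (suc k) (suc n) = step (approximant k) n

    -- `step` preserves agreement through a given degree, and the factor X then gains one degree per
    -- iteration.
    approximant-suc : ∀ k → approximant k ≈[≤ k ] approximant (suc k)
    approximant-suc k       zero    _         = refl
    approximant-suc (suc k) (suc n) (s≤s n≤k) = step-local (approximant-suc k) n n≤k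

    limit : Series
    limit n = approximant n n

    approximant-limit : ∀ {n k} → n ≤′ k → approximant k n ≈ limit n
    approximant-limit ≤′-refl           = refl
    approximant-limit (≤′-step {k} n≤k) =
      trans (sym (approximant-suc k _ (ℕ.≤′⇒≤ n≤k))) (approximant-limit n≤k)

    -- The coefficient on the left is that of degree `n` in `step` of the `n`th iterate, which
    -- agrees with the limit through degree `n`.
    limit-suc : ∀ n → limit (suc n) ≈ step limit n
    limit-suc n = step-local (λ i i≤n → approximant-limit (ℕ.≤⇒≤′ i≤n)) n ℕ.≤-refl

  opaque
    unfolding commutativeRing

    X*-suc : ∀ f n → coefficient (X R⟦X⟧.* f) (suc n) ≈ coefficient f n
    X*-suc f n = trans (+-cong (zeroˡ _) (⊛-local {g = f} {f} tail-X (λ _ _ → refl) n ℕ.≤-refl))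
                       (trans (+-identityˡ _) (R⟦X⟧.*-identityˡ f n))
      where
      tail-X : (λ n → X (suc n)) ≈[≤ n ] constant 1#
      tail-X zero    _ = refl
      tail-X (suc _) _ = refl

    fixed-point : ∀ a b → ∃ λ q → q R⟦X⟧.≈ R⟦X⟧.1# R⟦X⟧.+ X R⟦X⟧.* (a R⟦X⟧.* q R⟦X⟧.+ b R⟦X⟧.* (q R⟦X⟧.* q))
    fixed-point a b = limit a b , λ
      { zero    → sym (trans (+-congˡ (trans (+-identityʳ _) (zeroˡ _))) (+-identityʳ 1#))
      ; (suc n) → trans (limit-suc a b n)
                        (sym (trans (+-identityˡ _) (X*-suc (step a b (limit a b)) n)))
      }

    regular-constant-term : ∀ f → Regular (coefficient f 0) → R⟦X⟧.Regular f
    regular-constant-term f f₀-reg = R⟦X⟧.mkRegular λ g → regular-series f f₀-reg g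

    regular-scalar : ∀ {a} → Regular a → R⟦X⟧.Regular (scalar a)
    regular-scalar {a} a-reg = regular-constant-term (scalar a) a-reg

    regular-1-scalar : ∀ {a} → Regular (1# - a) → R⟦X⟧.Regular (R⟦X⟧.1# R⟦X⟧.- scalar a)
    regular-1-scalar {a} reg = regular-constant-term (R⟦X⟧.1# R⟦X⟧.- scalar a) reg

    regular-X : R⟦X⟧.Regular X
    regular-X = R⟦X⟧.mkRegular regular-indeterminate

    -- With `f = q` the series is the square root `s = p + k` of `Root` below, so this selects the
    -- branch with constant term 1.
    constant-term-1 : ∀ a f → (let open R⟦X⟧ using () renaming (_+_ to _⊕_; _-_ to _⊖_; _*_ to _⊗_; 1# to 1′) in
      coefficient ((1′ ⊖ a ⊗ X ⊗ f) ⊕ (X ⊖ a ⊗ X ⊗ f)) 0 ≈ 1#)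
    constant-term-1 a f = trans
      (+-cong (trans (+-congˡ -m₀) (+-identityʳ 1#)) (trans (+-congˡ -m₀) (+-identityʳ 0#)))
      (+-identityʳ 1#)
      where
      open RingProperties ring using (-0#≈0#)
      m₀ : (a 0 * 0# + 0#) * f 0 + 0# ≈ 0#
      m₀ = trans (+-identityʳ _) (trans (*-congʳ (trans (+-identityʳ _) (zeroʳ _))) (zeroˡ _))
      -m₀ : - ((a 0 * 0# + 0#) * f 0 + 0#) ≈ 0#
      -m₀ = trans (-‿cong m₀) -0#≈0#

  -- The case b = 0 of the fixed point: `h` is the inverse of 1 - X f.
  geometric : ∀ f → ∃ λ h → h R⟦X⟧.≈ R⟦X⟧.1# R⟦X⟧.+ X R⟦X⟧.* f R⟦X⟧.* h
  geometric f with fixed-point f R⟦X⟧.0#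
  ... | h , eq = h , R⟦X⟧.trans eq (solve 3 (λ x f h →
      con 1 :+ x :* (f :* h :+ con 0 :* (h :* h)) := con 1 :+ x :* f :* h) R⟦X⟧.refl X f h)
    where open SemiringSolver R⟦X⟧.commutativeSemiring using (solve; _:=_; _:*_; _:+_; con)

-- Regularity of 1 - X among polynomials.

module PolynomialRegularity {c ℓ} (R : CommutativeRing c ℓ) where

  open Over R
  open PowerSeries R using (regular-series)
  open Polynomials R
  open RingProperties ring using (-0#≈0#)
  private
    module R[X] = Over commutativeRing

  opaque
    unfolding commutativeRing PowerSeries.commutativeRing

    regular-1-X : R[X].Regular (R[X].1# R[X].- X)
    regular-1-X = R[X].mkRegular λ (g , _) → regular-series (proj₁ (R[X].1# R[X].- X))
      (Regular-cong (sym (trans (+-congˡ -0#≈0#) (+-identityʳ 1#))) Regular-1#) g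

-- The first identity, in the ring of fractions.

module Rational {c ℓ} (R : CommutativeRing c ℓ) where

  open Over R
  open Fractions R using (_/_∵_)
  private
    module K = Over (Fractions.commutativeRing R)
    module W = LetterWeights (Fractions.commutativeRing R)
  open SemiringSolver commutativeSemiring using (solve; _:=_; _:*_; _:+_; con)

  A≈P : ∀ {½} → ½ + ½ ≈ 1# → ∀ {n} → 1 ≤ n → (Π : PermutationSet n) → Invariant Π →
    ∀ y t (r₁ : Regular 1#) (r₂ : Regular (1# + y)) (r₃ : Regular ((y + t) * (1# + y * t))) (r₄ : Regular (1# + y * t)) →
    K.A Π (t / 1# ∵ r₁) K.≈
      (((1# + y * t) / (1# + y) ∵ r₂) K.^ suc n)
        K.* K.P Π (((1# + y) ^ 2 * t) / ((y + t) * (1# + y * t)) ∵ r₃) ((y + t) / (1# + y * t) ∵ r₄)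
  A≈P {½} ½+½≈1 1≤n Π inv y t r₁ r₂ r₃ r₄ = W.A-transform {½ = ½ / 1# ∵ r₁}
    (trans (solve 1 (λ h → (h :* con 1 :+ h :* con 1) :* con 1 := h :+ h) refl ½)
      (trans ½+½≈1 (solve 0 (con 1 := con 1 :* (con 1 :* con 1)) refl)))
    1≤n Π inv {t / 1# ∵ r₁} {(1# + y * t) / (1# + y) ∵ r₂}
    {((1# + y) ^ 2 * t) / ((y + t) * (1# + y * t)) ∵ r₃} {(y + t) / (1# + y * t) ∵ r₄}
    -- e²YT = t by cancellation alone, with 1 + yt, 1 + y and y + t treated as atoms.
    (solve 4 (λ a b c t →
      t :* (b :* b :* ((c :* a) :* a)) := (a :* a :* (b :* (b :* con 1) :* t :* c)) :* con 1) refl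
      (1# + y * t) (1# + y) (y + t) t)
    -- e + eT = 1 + t rests on (1 + yt) + (y + t) = (1 + y)(1 + t), so here the sums are expanded.
    (solve 2 (λ y t → let a = con 1 :+ y :* t ; b = con 1 :+ y ; c = y :+ t in
      (con 1 :* con 1 :+ t :* con 1) :* (b :* (b :* a)) :=
      (a :* (b :* a) :+ (a :* c) :* b) :* (con 1 :* con 1)) refl y t)

-- The algebra of the second identity, from a root of the quadratic equation.

module Quadratic {c ℓ} (R : CommutativeRing c ℓ) where

  open Over R
  open SetoidReasoning setoid
  open GroupProperties +-group using () renaming (∙-cancelʳ to +-cancelʳ)
  open SemiringSolver commutativeSemiring using (solve; _:=_; _:*_; _:+_; con)

  x-y+y≈x : ∀ x y → x - y + y ≈ x
  x-y+y≈x x y = trans (+-assoc x (- y) y) (trans (+-congˡ (-‿inverseˡ y)) (+-identityʳ x))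

  -- Lets an identity with subtractions be proved as an identity of sums.
  x+y≈z⇒x≈z-y : ∀ {x y z} → x + y ≈ z → x ≈ z - y
  x+y≈z⇒x≈z-y {x} {y} {z} eq = +-cancelʳ y x (z - y) (trans eq (sym (x-y+y≈x z y)))

  inverse⇒regular : ∀ {q q⁻¹} → q * q⁻¹ ≈ 1# → Regular q
  inverse⇒regular {q} {q⁻¹} inv = mkRegular λ p qp≈0 → begin
    p              ≈⟨ *-identityˡ p ⟨
    1# * p         ≈⟨ *-congʳ inv ⟨
    q * q⁻¹ * p    ≈⟨ solve 3 (λ a b p → a :* b :* p := b :* (a :* p)) refl q q⁻¹ p ⟩
    q⁻¹ * (q * p)  ≈⟨ *-congˡ qp≈0 ⟩
    q⁻¹ * 0#       ≈⟨ zeroʳ q⁻¹ ⟩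
    0#             ∎

  half⇒regular-2 : ∀ {½} → ½ + ½ ≈ 1# → Regular 2#
  half⇒regular-2 {½} eq = inverse⇒regular (trans
    (solve 1 (λ h → (con 1 :+ con 1) :* h := h :+ h) refl ½) eq)

  -- The unknown is q = 1 / r, a root of 1 - (1 + t) q + y t q² = 0; in terms
  -- of it m = y t q = 1 + t - r, p = r - t, k = r - 1 and s = 2 r - 1 - t.
  module Root (y t q h : Carrier) where

    m p k u v r s : Carrier
    m = y * t * q
    p = 1# - m
    k = t - m
    u = k * h
    v = m * q
    r = 1# + k
    s = p + k

    -- `h` and `g` are the inverses of 1 - m and 1 - v: the first performs the division in `u`, the
    -- second makes 1 + uv invertible.
    module Solution {g : Carrier}
      (q-eq : q + t * q ≈ 1# + m * q) (h-eq : h ≈ 1# + m * h) (g-eq : g ≈ 1# + v * g) where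

      private
        p+m≈1 : p + m ≈ 1#
        p+m≈1 = x-y+y≈x 1# m

        k+m≈t : k + m ≈ t
        k+m≈t = x-y+y≈x t m

        -- This is the quadratic equation with t written as k + m.
        rq≈1 : r * q ≈ 1#
        rq≈1 = +-cancelʳ (m * q) _ _ (begin
          (1# + k) * q + m * q    ≈⟨ solve 3 (λ k m q → (con 1 :+ k) :* q :+ m :* q := q :+ (k :+ m) :* q) refl k m q ⟩
          q + (k + m) * q         ≈⟨ +-congˡ (*-congʳ k+m≈t) ⟩
          q + t * q               ≈⟨ q-eq ⟩
          1# + m * q              ∎)

        s+m≈r : s + m ≈ r
        s+m≈r = begin
          p + k + m      ≈⟨ solve 3 (λ p k m → p :+ k :+ m := (p :+ m) :+ k) refl p k m ⟩
          (p + m) + k    ≈⟨ +-congʳ p+m≈1 ⟩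
          1# + k         ∎

        r+m≈1+t : r + m ≈ 1# + t
        r+m≈1+t = trans (+-assoc 1# k m) (+-congˡ k+m≈t)

        s+m+m≈1+t : s + m + m ≈ 1# + t
        s+m+m≈1+t = trans (+-congʳ s+m≈r) r+m≈1+t

        yt≈rm : y * t ≈ r * m
        yt≈rm = begin
          y * t                ≈⟨ *-identityʳ _ ⟨
          y * t * 1#           ≈⟨ *-congˡ rq≈1 ⟨
          y * t * (r * q)      ≈⟨ solve 4 (λ y t r q → y :* t :* (r :* q) := r :* (y :* t :* q)) refl y t r q ⟩
          r * m                ∎

        yt≈[s+m]m : y * t ≈ (s + m) * m
        yt≈[s+m]m = trans yt≈rm (*-congʳ (sym s+m≈r))

        rv≈m : r * v ≈ m
        rv≈m = begin
          r * (m * q)    ≈⟨ solve 3 (λ r m q → r :* (m :* q) := m :* (r :* q)) refl r m q ⟩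
          m * (r * q)    ≈⟨ *-congˡ rq≈1 ⟩
          m * 1#         ≈⟨ *-identityʳ m ⟩
          m              ∎

        ph≈1 : p * h ≈ 1#
        ph≈1 = +-cancelʳ (m * h) _ _ (begin
          p * h + m * h  ≈⟨ distribʳ h p m ⟨
          (p + m) * h    ≈⟨ *-congʳ p+m≈1 ⟩
          1# * h         ≈⟨ *-identityˡ h ⟩
          h              ≈⟨ h-eq ⟩
          1# + m * h     ∎)

        pu≈k : p * u ≈ k
        pu≈k = begin
          p * (k * h)    ≈⟨ solve 3 (λ p k h → p :* (k :* h) := k :* (p :* h)) refl p k h ⟩
          k * (p * h)    ≈⟨ *-congˡ ph≈1 ⟩
          k * 1#         ≈⟨ *-identityʳ k ⟩
          k              ∎

        -- From t = k + m and p + m = 1 one gets t = k p + r m, where r m = y t.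
        [1-y]t≈kp : (1# - y) * t ≈ k * p
        [1-y]t≈kp = +-cancelʳ (y * t) _ _ (begin
          (1# - y) * t + y * t    ≈⟨ distribʳ t (1# - y) y ⟨
          (1# - y + y) * t        ≈⟨ *-congʳ (x-y+y≈x 1# y) ⟩
          1# * t                  ≈⟨ *-identityˡ t ⟩
          t                       ≈⟨ k+m≈t ⟨
          k + m                   ≈⟨ +-congʳ (*-identityʳ k) ⟨
          k * 1# + m              ≈⟨ +-congʳ (*-congˡ p+m≈1) ⟨
          k * (p + m) + m         ≈⟨ solve 3 (λ k p m → k :* (p :+ m) :+ m := k :* p :+ (con 1 :+ k) :* m) refl k p m ⟩
          k * p + r * m           ≈⟨ +-congˡ yt≈rm ⟨
          k * p + y * t           ∎)

      -- Completing the square: s + 2m = 1 + t and y t = (s + m) m.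
      s² : s * s ≈ (1# + t) ^ 2 - (2# * 2#) * y * t
      s² = x+y≈z⇒x≈z-y (begin
        s * s + (2# * 2#) * y * t
          ≈⟨ +-congˡ (*-assoc (2# * 2#) y t) ⟩
        s * s + (2# * 2#) * (y * t)
          ≈⟨ +-congˡ (*-congˡ yt≈[s+m]m) ⟩
        s * s + (2# * 2#) * ((s + m) * m)
          ≈⟨ solve 2 (λ s m → s :* s :+ ((con 1 :+ con 1) :* (con 1 :+ con 1)) :* ((s :+ m) :* m) :=
                              (s :+ m :+ m) :* ((s :+ m :+ m) :* con 1)) refl s m ⟩
        (s + m + m) ^ 2
          ≈⟨ *-cong s+m+m≈1+t (*-congʳ s+m+m≈1+t) ⟩
        (1# + t) ^ 2  ∎)

      -- Since y t v = m², moving the subtracted terms across leaves (s + 2m)² = (1 + t)².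
      2ytv : 2# * y * t * v ≈ (1# + t) ^ 2 - 2# * y * t - (1# + t) * s
      2ytv = x+y≈z⇒x≈z-y (x+y≈z⇒x≈z-y (begin
        2# * y * t * v + (1# + t) * s + 2# * y * t
          ≈⟨ solve 4 (λ y t v s → (con 1 :+ con 1) :* y :* t :* v :+ (con 1 :+ t) :* s :+ (con 1 :+ con 1) :* y :* t :=
                                  (con 1 :+ con 1) :* ((y :* t) :* v :+ y :* t) :+ (con 1 :+ t) :* s) refl y t v s ⟩
        2# * (y * t * v + y * t) + (1# + t) * s
          ≈⟨ +-cong (*-congˡ (+-cong ytv≈mm yt≈[s+m]m)) (*-congʳ (sym s+m+m≈1+t)) ⟩
        2# * (m * m + (s + m) * m) + (s + m + m) * s
          ≈⟨ solve 2 (λ s m → (con 1 :+ con 1) :* (m :* m :+ (s :+ m) :* m) :+ (s :+ m :+ m) :* s :=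
                              (s :+ m :+ m) :* ((s :+ m :+ m) :* con 1)) refl s m ⟩
        (s + m + m) ^ 2
          ≈⟨ *-cong s+m+m≈1+t (*-congʳ s+m+m≈1+t) ⟩
        (1# + t) ^ 2  ∎))
        where
        ytv≈mm : y * t * v ≈ m * m
        ytv≈mm = begin
          y * t * v      ≈⟨ *-congʳ yt≈rm ⟩
          r * m * v      ≈⟨ solve 3 (λ r m v → r :* m :* v := m :* (r :* v)) refl r m v ⟩
          m * (r * v)    ≈⟨ *-congˡ rv≈m ⟩
          m * m          ∎

      2[1-y]tu : 2# * (1# - y) * t * u ≈ 1# + t ^ 2 - 2# * y * t - (1# - t) * s
      -- Adding t s to both sides turns (1 - t) s into s; moreover (1 - y) t u = k².
      2[1-y]tu = x+y≈z⇒x≈z-y (x+y≈z⇒x≈z-y (+-cancelʳ (t * s) _ _ (begin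
        2# * (1# - y) * t * u + (1# - t) * s + 2# * y * t + t * s
          ≈⟨ solve 6 (λ 1-y t u 1-t s y →
               (con 1 :+ con 1) :* 1-y :* t :* u :+ 1-t :* s :+ (con 1 :+ con 1) :* y :* t :+ t :* s :=
               (con 1 :+ con 1) :* (1-y :* t :* u) :+ (1-t :+ t) :* s :+ (con 1 :+ con 1) :* (y :* t))
               refl (1# - y) t u (1# - t) s y ⟩
        2# * ((1# - y) * t * u) + (1# - t + t) * s + 2# * (y * t)
          ≈⟨ +-cong (+-cong (*-congˡ [1-y]tu≈kk) (trans (*-congʳ (x-y+y≈x 1# t)) (*-identityˡ s))) (*-congˡ yt≈rm) ⟩
        2# * (k * k) + s + 2# * (r * m)
          ≈⟨ solve 3 (λ k p m → (con 1 :+ con 1) :* (k :* k) :+ (p :+ k) :+ (con 1 :+ con 1) :* ((con 1 :+ k) :* m) :=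
                                (p :+ m) :+ ((m :+ k) :+ (con 1 :+ con 1) :* (m :* k :+ k :* k))) refl k p m ⟩
        (p + m) + ((m + k) + 2# * (m * k + k * k))
          -- The linear term m + k is multiplied by p + m = 1, so that all terms but the leading 1
          -- are quadratic.
          ≈⟨ +-cong p+m≈1 (+-congʳ (trans (sym (*-identityˡ _)) (*-congʳ (sym p+m≈1)))) ⟩
        1# + ((p + m) * (m + k) + 2# * (m * k + k * k))
          ≈⟨ solve 3 (λ k p m → con 1 :+ ((p :+ m) :* (m :+ k) :+ (con 1 :+ con 1) :* (m :* k :+ k :* k)) :=
                                con 1 :+ (k :+ m) :* ((k :+ m) :* con 1) :+ (k :+ m) :* (p :+ k)) refl k p m ⟩
        1# + (k + m) ^ 2 + (k + m) * s
          ≈⟨ +-cong (+-congˡ (*-cong k+m≈t (*-congʳ k+m≈t))) (*-congʳ k+m≈t) ⟩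
        1# + t ^ 2 + t * s  ∎)))
        where
        [1-y]tu≈kk : (1# - y) * t * u ≈ k * k
        [1-y]tu≈kk = trans (*-congʳ [1-y]t≈kp) (trans (*-assoc k p u) (*-congˡ pu≈k))

      -- Multiplication by p turns 1 + uv into p + kv, which is 1 - v because r v = m; hence p g is
      -- an inverse.
      regular-1+uv : Regular (1# + u * v)
      regular-1+uv = inverse⇒regular {q⁻¹ = p * g} (begin
        (1# + u * v) * (p * g)          ≈⟨ solve 4 (λ u v p g → (con 1 :+ u :* v) :* (p :* g) := (p :+ p :* u :* v) :* g) refl u v p g ⟩
        (p + p * u * v) * g             ≈⟨ *-congʳ (+-congˡ (*-congʳ pu≈k)) ⟩
        (p + k * v) * g                 ≈⟨ +-cancelʳ (v * g) _ _ (begin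
          (p + k * v) * g + v * g         ≈⟨ solve 4 (λ p k v g → (p :+ k :* v) :* g :+ v :* g := (p :+ (con 1 :+ k) :* v) :* g) refl p k v g ⟩
          (p + r * v) * g                 ≈⟨ *-congʳ (trans (+-congˡ rv≈m) p+m≈1) ⟩
          1# * g                          ≈⟨ *-identityˡ g ⟩
          g                               ≈⟨ g-eq ⟩
          1# + v * g                      ∎) ⟩
        1#                              ∎)

      [1+uv]r : (1# + u * v) * r ≈ 1# + u
      [1+uv]r = begin
        (1# + u * v) * r      ≈⟨ solve 3 (λ u v r → (con 1 :+ u :* v) :* r := r :+ u :* (r :* v)) refl u v r ⟩
        1# + k + u * (r * v)  ≈⟨ +-cong (+-congˡ (sym pu≈k)) (*-congˡ rv≈m) ⟩
        1# + p * u + u * m    ≈⟨ solve 3 (λ p u m → con 1 :+ p :* u :+ u :* m := con 1 :+ (p :+ m) :* u) refl p u m ⟩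
        1# + (p + m) * u      ≈⟨ +-congˡ (trans (*-congʳ p+m≈1) (*-identityˡ u)) ⟩
        1# + u                ∎

      -- The two invariants agree: r² v = r m = y t and r + r v = r + m = 1 + t.
      P≈A : ∀ {½} → ½ + ½ ≈ 1# → ∀ {n} → 1 ≤ n → (Π : PermutationSet n) → Invariant Π →
            P Π y t ≈ r ^ suc n * A Π v
      P≈A ½+½≈1 {n} 1≤n Π inv = begin
        P Π y t               ≈⟨ trans (*-congʳ (W.1^n≈1 (suc n))) (*-identityˡ _) ⟨
        1# ^ suc n * P Π y t  ≈⟨ W.P-transform ½+½≈1 1≤n Π inv (begin
          1# * 1# * (y * t)     ≈⟨ solve 1 (λ a → con 1 :* con 1 :* a := a) refl (y * t) ⟩
          y * t                 ≈⟨ yt≈rm ⟩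
          r * m                 ≈⟨ *-congˡ rv≈m ⟨
          r * (r * v)           ≈⟨ solve 2 (λ r v → r :* (r :* v) := r :* r :* (con 1 :* v)) refl r v ⟩
          r * r * (1# * v)      ∎)
                                   (begin
          1# + 1# * t           ≈⟨ +-congˡ (*-identityˡ t) ⟩
          1# + t                ≈⟨ r+m≈1+t ⟨
          r + m                 ≈⟨ +-congˡ rv≈m ⟨
          r + r * v             ∎) ⟩
        r ^ suc n * P Π 1# v  ≈⟨ *-congˡ (W.P-1 Π v) ⟩
        r ^ suc n * A Π v     ∎
        where module W = LetterWeights R

-- The second identity, in the ring of power series.

module SeriesSolution {c ℓ} (R : CommutativeRing c ℓ) where

  open PowerSeries R using (IsSqrt)
  open FixedPoint R
  private
    module R = Over R
    R⟦X⟧ : CommutativeRing c ℓ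
    R⟦X⟧ = PowerSeries.commutativeRing R

    t : CommutativeRing.Carrier R⟦X⟧
    t = PowerSeries.X R

  open Over R⟦X⟧
  open RingProperties ring using (-‿distribˡ-*)
  open SetoidReasoning setoid
  open SemiringSolver commutativeSemiring using (solve; _:=_; _:*_; _:+_; con)

  -- The element `a` plays the part of the indeterminate y; regularity of `a` and of 1 - a makes the
  -- denominators of v and u regular.
  solution : ∀ {½} → ½ R.+ ½ R.≈ R.1# → ∀ {a} → R.Regular a → R.Regular (R.1# R.- a) →
    (let y = PowerSeries.scalar R a) →
    ∀ {n} → 1 ≤ n → (Π : PermutationSet n) → Invariant Π →
    Σ[ s ∈ Carrier ] Σ[ u ∈ Carrier ] Σ[ v ∈ Carrier ] Σ[ r ∈ Carrier ]
      IsSqrt s ((1# + t) ^ 2 - (2# * 2#) * y * t)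
    × (u ≈ (1# + t ^ 2 - 2# * y * t - (1# - t) * s) ÷ (2# * (1# - y) * t))
    × (v ≈ ((1# + t) ^ 2 - 2# * y * t - (1# + t) * s) ÷ (2# * y * t))
    × (r ≈ (1# + u) ÷ (1# + u * v))
    × (P Π y t ≈ (r ^ suc n) * A Π v)
  solution ½+½≈1 {a} reg-a reg-1-a 1≤n Π inv
    -- q = 1 + t (-q + y q²) is the quadratic equation for q.
    with fixed-point (- 1#) (PowerSeries.scalar R a)
  ... | q , q-fixed
    -- These are 1 / (1 - m) and 1 / (1 - v), with m = y t q and v = y t q².
    with geometric (PowerSeries.scalar R a * q) | geometric (PowerSeries.scalar R a * (q * q))
  ... | h , h-fixed | g , g-fixed =
    Root.s , Root.u , Root.v , Root.r , (Q.s² , constant-term-1 y q)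
      , (Regular-* (Regular-* reg-2 (regular-1-scalar reg-1-a)) regular-X , Q.2[1-y]tu)
      , (Regular-* (Regular-* reg-2 (regular-scalar reg-a)) regular-X , Q.2ytv)
      , (Q.regular-1+uv , Q.[1+uv]r)
      , Q.P≈A half 1≤n Π inv
    where
    y : Carrier
    y = PowerSeries.scalar R a

    module Root = Quadratic.Root R⟦X⟧ y t q h

    half : PowerSeries.scalar R _ + PowerSeries.scalar R _ ≈ 1#
    half = Halves.scalar-half-series R ½+½≈1

    reg-2 : Regular 2#
    reg-2 = Quadratic.half⇒regular-2 R⟦X⟧ half

    q-eq : q + t * q ≈ 1# + y * t * q * q
    q-eq = begin
      q + t * q
        ≈⟨ +-congʳ q-fixed ⟩
      1# + t * (- 1# * q + y * (q * q)) + t * q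
        ≈⟨ solve 4 (λ n t y q → con 1 :+ t :* (n :* q :+ y :* (q :* q)) :+ t :* q :=
                                con 1 :+ y :* t :* q :* q :+ t :* ((n :+ con 1) :* q)) refl (- 1#) t y q ⟩
      1# + y * t * q * q + t * ((- 1# + 1#) * q)
        ≈⟨ +-congˡ (trans (*-congˡ (trans (*-congʳ (-‿inverseˡ 1#)) (zeroˡ q))) (zeroʳ t)) ⟩
      1# + y * t * q * q + 0#
        ≈⟨ +-identityʳ _ ⟩
      1# + y * t * q * q  ∎

    h-eq : h ≈ 1# + y * t * q * h
    h-eq = trans h-fixed (solve 4 (λ t y q h → con 1 :+ t :* (y :* q) :* h := con 1 :+ y :* t :* q :* h) refl t y q h)

    g-eq : g ≈ 1# + y * t * q * q * g
    g-eq = trans g-fixed (solve 4 (λ t y q g → con 1 :+ t :* (y :* (q :* q)) :* g := con 1 :+ y :* t :* q :* q :* g) refl t y q g)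

    module Q = Root.Solution q-eq h-eq g-eq

theorem5p1 :
    (n : ℕ) → 1 ≤ n →
    (Π : PermutationSet n) → Invariant Π →
    (let open CommutativeRing ℚ[y,t]
         open RationalFunctions
         module K = Over ℚ⟨y,t⟩
         open Over ℚ[y,t] using (_^_)
     in  K.A Π (t / 1# ∵ regular-1)
           K.≈
         (((1# + y * t) / (1# + y) ∵ regular-1+y) K.^ suc n)
           K.* K.P Π (((1# + y) ^ 2 * t) / ((y + t) * (1# + y * t)) ∵ regular-[y+t][1+yt])
                     ((y + t) / (1# + y * t) ∵ regular-1+yt))
    ×
    (let open Over ℚ[y]⟦t⟧
         open FormalPowerSeries
     in  Σ[ s ∈ Carrier ] Σ[ u ∈ Carrier ] Σ[ v ∈ Carrier ] Σ[ r ∈ Carrier ]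
           IsSqrt s ((1# + t) ^ 2 - (2# * 2#) * y * t)
         × (u ≈ (1# + t ^ 2 - 2# * y * t - (1# - t) * s) ÷ (2# * (1# - y) * t))
         × (v ≈ ((1# + t) ^ 2 - 2# * y * t - (1# + t) * s) ÷ (2# * y * t))
         × (r ≈ (1# + u) ÷ (1# + u * v))
         × (P Π y t ≈ (r ^ suc n) * A Π v))
theorem5p1 n 1≤n Π inv =
    Rational.A≈P ℚ[y,t] (Halves.scalar-half-polynomial ℚ[y] half-ℚ[y]) 1≤n Π inv
      RationalFunctions.y RationalFunctions.t RationalFunctions.regular-1 RationalFunctions.regular-1+y
      RationalFunctions.regular-[y+t][1+yt] RationalFunctions.regular-1+yt
  , SeriesSolution.solution ℚ[y] half-ℚ[y] (Polynomials.regular-X +-*-commutativeRing)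
      (PolynomialRegularity.regular-1-X +-*-commutativeRing) 1≤n Π inv
  where
  half-ℚ[y] : CommutativeRing._≈_ ℚ[y] (CommutativeRing._+_ ℚ[y] _ _) (CommutativeRing.1# ℚ[y])
  half-ℚ[y] = Halves.scalar-half-polynomial +-*-commutativeRing {ℚ.½} ≡.refl
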